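{- Let $r\ge 2$ be an integer and let $s,s_3,\dots,s_r,t_3,\dots,t_r$ be positive integers with $t_i\ge s_i$ for all $i\in\{3,\dots,r\}$. Then, as $n\to\infty$ (with all the other parameters fixed), $$\hat r(K_{s,n},K_{s,n},K_{s_3,t_3},\dots,K_{s_r,t_r})=n\cdot\min\{a\cdot f(a): a\in\mathbb N,\ a>\sigma\}+O(1),$$ where $\sigma=2s-r+\sum_{i=3}^r s_i$ and $$f(a)=\frac{2\binom as}{\binom{\lfloor a'/2\rfloor}s+\binom{\lceil a'/2\rceil}s},\qquad a'=a-\sum_{i=3}^r(s_i-1).$$
   Context: All graphs are finite and simple; $K_{m,n}$ is the complete bipartite graph with parts of sizes $m$ and $n$. For graphs $G,H_1,\dots,H_r$ write $G\to(H_1,\dots,H_r)$ if for every colouring $E(G)\to\{1,\dots,r\}$ there is $i$ such that the graph formed by the edges of colour $i$ contains a copy of $H_i$ as a (not necessarily induced) subgraph. The size Ramsey number is $\hat r(H_1,\dots,H_r)=\min\{e(G): G\to(H_1,\dots,H_r)\}$, where $e(G)$ is the number of edges of $G$. (For $r=2$ the list of forbidden graphs is just $K_{s,n},K_{s,n}$, and the sums over $i$ are empty.) -}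

module Defs where

open import Data.Fin.Base as Fin using (Fin; splitAt)
import Data.Fin.Properties as Fin
import Data.Integer.Base as ℤ
open import Data.List.Base using (List; allFin; cartesianProduct; filter; length)
open import Data.Nat.Base as ℕ
  using (ℕ; zero; suc; _+_; _*_; _∸_; _≤_; _<_; _>_; s≤s; z≤n; ⌊_/2⌋; ⌈_/2⌉; NonZero; >-nonZero)
open import Data.Nat.Combinatorics using (_C_; nCk≡nC[n∸k]; nCn≡1; nCk+nC[k+1]≡[n+1]C[k+1])
import Data.Nat.Properties as ℕ
open import Data.Product using (Σ-syntax; ∃-syntax; _×_; _,_; proj₁)
open import Data.Rational.Base as ℚ using (ℚ)
open import Data.Sum.Base using (_⊎_; inj₁; inj₂)
open import Data.Vec.Functional using (Vector; head; tail)
open import Function.Base using (_∘_)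
open import Function.Definitions using (Injective)
open import Level using (0ℓ; _⊔_)
open import Relation.Binary.Core using (Rel)
open import Relation.Binary.Definitions using (Decidable; Irreflexive; Symmetric)
open import Relation.Binary.PropositionalEquality
open import Relation.Nullary.Decidable using (Dec; yes; no; _×-dec_)
open import Relation.Nullary.Negation using (¬_)
open import Relation.Unary using (Pred)
open import Algebra.Properties.CommutativeMonoid.Sum ℕ.+-0-commutativeMonoid using (sum)

IsLeast : ∀ {a ℓ p} {A : Set a} → Rel A ℓ → Pred A p → Pred A (a ⊔ ℓ ⊔ p)
IsLeast _≼_ P m = P m × (∀ x → P x → m ≼ x)

record Graph : Set₁ where
  infix 4 _~_ _~?_
  field
    order    : ℕ
    _~_      : Rel (Fin order) 0ℓ
    _~?_     : Decidable _~_
    ~-sym    : Symmetric _~_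
    ~-irrefl : Irreflexive _≡_ _~_

-- Each edge {u , v} is listed once, as the pair with u < v.
edges : (G : Graph) → List (Fin (Graph.order G) × Fin (Graph.order G))
edges G = filter (λ (u , v) → (u Fin.<? v) ×-dec (u ~? v))
                 (cartesianProduct (allFin order) (allFin order))
  where open Graph G

e : Graph → ℕ
e = length ∘ edges

data Opposite {A B : Set} : Rel (A ⊎ B) 0ℓ where
  left-right : ∀ {a b} → Opposite (inj₁ a) (inj₂ b)
  right-left : ∀ {a b} → Opposite (inj₂ b) (inj₁ a)

opposite? : ∀ {A B} → Decidable (Opposite {A} {B})
opposite? (inj₁ _) (inj₁ _) = no λ ()
opposite? (inj₁ _) (inj₂ _) = yes left-right
opposite? (inj₂ _) (inj₁ _) = yes right-left
opposite? (inj₂ _) (inj₂ _) = no λ ()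

opposite-sym : ∀ {A B} → Symmetric (Opposite {A} {B})
opposite-sym left-right = right-left
opposite-sym right-left = left-right

opposite-irrefl : ∀ {A B} {x : A ⊎ B} → ¬ Opposite x x
opposite-irrefl ()

K : ℕ → ℕ → Graph
K m n = record
  { order    = m + n
  ; _~_      = λ u v → Opposite (splitAt m u) (splitAt m v)
  ; _~?_     = λ u v → opposite? (splitAt m u) (splitAt m v)
  ; ~-sym    = opposite-sym
  ; ~-irrefl = λ { refl → opposite-irrefl }
  }

-- Not necessarily induced: non-edges of H may be mapped to edges of G.
record _ContainsCopyOf_ (G H : Graph) : Set where
  private
    module G = Graph G
    module H = Graph H
  field
    embed     : Fin H.order → Fin G.order
    injective : Injective _≡_ _≡_ embed
    preserves : ∀ {u v} → u H.~ v → embed u G.~ embed v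

-- By colour-sym, applied twice, a colour does not depend on the proof of
-- adjacency, so this is a function on the set of unordered edges.
record EdgeColouring (G : Graph) (r : ℕ) : Set where
  open Graph G
  field
    colour     : ∀ {u v} → u ~ v → Fin r
    colour-sym : ∀ {u v} (p : u ~ v) (q : v ~ u) → colour p ≡ colour q

colourClass : ∀ {G r} → EdgeColouring G r → Fin r → Graph
colourClass {G} {r} c i = record
  { order    = order
  ; _~_      = λ u v → ∃[ p ] colour {u} {v} p ≡ i
  ; _~?_     = inClass?
  ; ~-sym    = λ (p , p≡i) → ~-sym p , trans (sym (colour-sym p (~-sym p))) p≡i
  ; ~-irrefl = λ u≡v (p , _) → ~-irrefl u≡v p
  }
  where
  open Graph G
  open EdgeColouring c
  inClass? : ∀ u v → Dec (∃[ p ] colour {u} {v} p ≡ i)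
  inClass? u v with u ~? v
  ... | no ¬p = no (¬p ∘ proj₁)
  ... | yes p with colour p Fin.≟ i
  ...   | yes p≡i = yes (p , p≡i)
  ...   | no  p≢i = no λ (q , q≡i) →
            p≢i (trans (colour-sym p (~-sym p)) (trans (colour-sym (~-sym p) q) q≡i))

infix 4 _⟶_

_⟶_ : ∀ {r} → Graph → Vector Graph r → Set
_⟶_ {r} G Hs = (c : EdgeColouring G r) → ∃[ i ] colourClass c i ContainsCopyOf Hs i

IsSizeRamseyNumber : ∀ {r} → Vector Graph r → ℕ → Set₁
IsSizeRamseyNumber Hs = IsLeast _≤_ (λ m → Σ[ G ∈ Graph ] (e G ≡ m × G ⟶ Hs))

fromℕ : ℕ → ℚ
fromℕ n = ℤ.+ n ℚ./ 1

nCk>0 : ∀ {n k} → k ≤ n → 0 < n C k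
nCk>0 {n} {zero} _ = ℕ.≤-reflexive (sym (trans (nCk≡nC[n∸k] {k = 0} {n = n} z≤n) (nCn≡1 n)))
nCk>0 {suc n} {suc k} (s≤s k≤n) =
  subst (0 <_) (nCk+nC[k+1]≡[n+1]C[k+1] n k) (ℕ.m≤n⇒m≤n+o _ (nCk>0 k≤n))

sum-pred : ∀ {k} (ss : Vector ℕ k) → (∀ i → 1 ≤ ss i) → k + sum (λ i → ss i ∸ 1) ≡ sum ss
sum-pred {zero}  ss ss≥1 = refl
sum-pred {suc k} ss ss≥1 = begin
  suc (k + (x + y)) ≡⟨ cong suc (ℕ.+-comm k (x + y)) ⟩
  suc (x + y + k)   ≡⟨ cong suc (ℕ.+-assoc x y k) ⟩
  suc x + (y + k)   ≡⟨ cong₂ _+_ (ℕ.m+[n∸m]≡n (ss≥1 Fin.zero)) (ℕ.+-comm y k) ⟩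
  head ss + (k + y) ≡⟨ cong (head ss +_) (sum-pred (tail ss) (ss≥1 ∘ Fin.suc)) ⟩
  sum ss            ∎
  where
  open ≡-Reasoning
  x = head ss ∸ 1
  y = sum (λ i → tail ss i ∸ 1)

-- With r = 2 + k colours, ss lists the k numbers s₃, …, s_r.
module Objective {k} (s : ℕ) (ss : Vector ℕ k) (s≥1 : 1 ≤ s) (ss≥1 : ∀ i → 1 ≤ ss i) where

  -- σ = 2s − r + Σᵢ sᵢ. Nothing is truncated, as s ≥ 1 and Σᵢ sᵢ ≥ k = r − 2.
  σ : ℕ
  σ = (2 * s + sum ss) ∸ (2 + k)

  -- Σᵢ (sᵢ − 1) = Σᵢ sᵢ − (r − 2) ≤ σ, so the subtraction is exact for a > σ.
  infix 8 _′
  _′ : ℕ → ℕ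
  a ′ = a ∸ sum (λ i → ss i ∸ 1)

  denominator : ℕ → ℕ
  denominator a = (⌊ a ′ /2⌋ C s) + (⌈ a ′ /2⌉ C s)

  private
    σ≡ : σ ≡ 2 * s + sum (λ i → ss i ∸ 1) ∸ 2
    σ≡ = begin
      2 * s + sum ss ∸ (2 + k)    ≡⟨ cong₂ (λ t d → 2 * s + t ∸ d) (sym (trans (ℕ.+-comm d k) (sum-pred ss ss≥1))) (ℕ.+-comm 2 k) ⟩
      2 * s + (d + k) ∸ (k + 2)   ≡⟨ cong (_∸ (k + 2)) (ℕ.+-assoc (2 * s) d k) ⟨
      2 * s + d + k ∸ (k + 2)     ≡⟨ ℕ.∸-+-assoc (2 * s + d + k) k 2 ⟨
      2 * s + d + k ∸ k ∸ 2       ≡⟨ cong (_∸ 2) (ℕ.m+n∸n≡m (2 * s + d) k) ⟩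
      2 * s + d ∸ 2               ∎
      where
      open ≡-Reasoning
      d = sum (λ i → ss i ∸ 1)

    half : ∀ s d a → 1 ≤ s → 2 * s + d ∸ 2 < a → s ≤ ⌈ a ∸ d /2⌉
    half (suc t) d a _ lt = begin
      suc t                               ≡⟨ cong suc (ℕ.n≡⌊n+n/2⌋ t) ⟩
      ⌈ suc (t + t) /2⌉                   ≡⟨ cong ⌈_/2⌉ (ℕ.m+n∸n≡m (suc (t + t)) d) ⟨
      ⌈ suc (t + t) + d ∸ d /2⌉           ≤⟨ ℕ.⌈n/2⌉-mono (ℕ.∸-monoˡ-≤ d bound) ⟩
      ⌈ a ∸ d /2⌉                         ∎
      where
      open ℕ.≤-Reasoning
      double : 2 * suc t ≡ 2 + (t + t)
      double = trans (cong (suc t +_) (ℕ.+-identityʳ (suc t))) (cong suc (ℕ.+-suc t t))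
      bound : suc (t + t) + d ≤ a
      bound = subst (λ x → x + d ∸ 2 < a) double lt

  denominator-nonZero : ∀ {a} → a > σ → NonZero (denominator a)
  denominator-nonZero {a} a>σ = >-nonZero
    (ℕ.m≤n⇒m≤o+n _ (nCk>0 (half s _ a s≥1 (subst (_< a) σ≡ a>σ))))

  f : (a : ℕ) → a > σ → ℚ
  f a a>σ = ℚ._/_ (ℤ.+ (2 * (a C s))) (denominator a) {{denominator-nonZero a>σ}}

  -- The set {a · f(a) : a ∈ ℕ, a > σ}.
  Values : Pred ℚ 0ℓ
  Values q = ∃[ a ] Σ[ a>σ ∈ a > σ ] q ≡ fromℕ a ℚ.* f a a>σ

{-# OPTIONS --safe #-}
-- Write fall b s = b (b − 1) ⋯ (b − s + 1) and D a = fall ⌊a′/2⌋ s + fall ⌈a′/2⌉ s, so that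
-- a · f(a) = a · 2 fall a s / D a. Both bounds count the pairs (S , x) in which the vertex x is
-- joined to the whole s-set S by edges of one of the first two colours.
--
-- Upper bound: colour K a m. All but O(1) vertices x of the large side have fewer than sᵢ edges
-- of each colour i ≥ 3, so at least a′ edges in the first two colours, and by convexity they lie
-- in at least D a pairs each, with S listed as an injection. If there is no monochromatic copy,
-- every S lies in fewer than n pairs per colour, so m D a ≤ 2 n fall a s + O(1).
--
-- Lower bound: the vertices of degree at least n (the hubs) are O(1) in number, and contain the
-- s-side of every K s n. Group the other vertices by their set A of neighbouring hubs, and
-- within each group run cyclically through all permutations of one urn with ⌊a′/2⌋, ⌈a′/2⌉ and
-- sᵢ − 1 balls of the respective colours (and its copy with the first two colours exchanged),
-- where a = ∣A∣. Up to O(1), each s-subset of A is then monochromatic for a fraction 1 / f(a) of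
-- the group in either of the first two colours. As 1 / f(a) ≤ a / μ, an s-set of hubs has at
-- most e(G) / μ + O(1) common neighbours in one colour.
--
-- The size Ramsey number exists constructively because, up to isolated vertices, there are
-- finitely many graphs with at most m edges, and finitely many colourings of each.
module Submission where

open import Defs
open import Algebra.Properties.Semiring.Sum using (*-distribˡ-sum; *-distribʳ-sum)
open import Data.Bool.Base using (Bool; true; false; if_then_else_)
open import Data.Fin.Base as Fin using (Fin; zero; suc; toℕ; splitAt; _↑ˡ_; _↑ʳ_; combine; remQuot; punchIn; punchOut; finToFun; funToFin; fromℕ<; inject≤)
import Data.Fin.Properties as Fin
import Data.Integer.Base as ℤ
import Data.Integer.Properties as ℤ
open import Data.Fin.Subset using (Subset; ∣_∣)
open import Data.Fin.Subset.Properties using (∣p∣≤n)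
open import Data.List.Base as List using (_++_; length; filter; cartesianProduct)
import Data.List.Properties as List
open import Data.Nat.Base as ℕ
open import Data.Nat.Combinatorics using (_C_; nCk≡nC[n∸k]; nCn≡1; nCk+nC[k+1]≡[n+1]C[k+1]; k>n⇒nCk≡0)
open import Data.Nat.Divisibility using (∣⇒≤; m≤n⇒m!∣n!)
open import Data.Nat.DivMod
import Data.Nat.Properties as ℕ
open import Data.Nat.Tactic.RingSolver using (solve-∀)
open import Data.Product using (Σ-syntax; ∃-syntax; _×_; _,_; proj₁; proj₂; uncurry)
open import Data.Rational.Base as ℚ using (ℚ)
import Data.Rational.Properties as ℚ
import Data.Rational.Unnormalised.Base as ℚᵘ
import Data.Rational.Unnormalised.Properties as ℚᵘ
open import Data.Sum.Base using (inj₁; inj₂; [_,_]′)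
open import Data.Vec.Base using (lookup; tabulate; []) renaming (_∷_ to _∷ᵛ_)
open import Data.Vec.Properties using (lookup∘tabulate)
open import Data.Vec.Functional using (Vector; _∷_; tail)
open import Function.Base using (_∘_; id; const; case_of_)
open import Function.Definitions using (Injective)
open import Level using (0ℓ)
open import Relation.Binary.Definitions using (tri<; tri≈; tri>)
open import Relation.Binary.PropositionalEquality
open import Relation.Nullary.Decidable
open import Relation.Nullary.Negation using (¬_; contradiction)
open import Relation.Unary as U using (Pred)
open import Algebra.Properties.CommutativeMonoid.Sum ℕ.+-0-commutativeMonoid using (sum; sum-cong-≗; ∑-distrib-+; ∑-comm; sum-remove)
open import Algebra.Properties.Group ℚ.+-0-group using (⁻¹-anti-homo-//)

-- Sums of indicators over Fin n

⟦_⟧ : ∀ {p} {P : Set p} → Dec P → ℕ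
⟦ d ⟧ = if does d then 1 else 0

bit : ∀ {p} {P : Set p} → Dec P → Fin 2
bit d = if does d then suc zero else zero

module _ {p} {P : Set p} where

  bit-yes : (d : Dec P) → P → bit d ≡ suc zero
  bit-yes (yes _) _ = refl
  bit-yes (no ¬p) p = contradiction p ¬p

  bit-yes⁻¹ : (d : Dec P) → bit d ≡ suc zero → P
  bit-yes⁻¹ (yes p) _ = p

  ⟦⟧-yes : (d : Dec P) → P → ⟦ d ⟧ ≡ 1
  ⟦⟧-yes (yes _) _ = refl
  ⟦⟧-yes (no ¬p) p = contradiction p ¬p

  ⟦⟧-no : (d : Dec P) → ¬ P → ⟦ d ⟧ ≡ 0
  ⟦⟧-no (yes p) ¬p = contradiction p ¬p
  ⟦⟧-no (no _)  _  = refl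

  ⟦⟧≤1 : (d : Dec P) → ⟦ d ⟧ ≤ 1
  ⟦⟧≤1 (yes _) = ℕ.≤-refl
  ⟦⟧≤1 (no _)  = z≤n

  ⟦⟧≤ : ∀ {n} (d : Dec P) → (P → 1 ≤ n) → ⟦ d ⟧ ≤ n
  ⟦⟧≤ (yes p) 1≤n = 1≤n p
  ⟦⟧≤ (no _)  _   = z≤n

⟦⟧-mono : ∀ {p q} {P : Set p} {Q : Set q} (d : Dec P) (d′ : Dec Q) → (P → Q) → ⟦ d ⟧ ≤ ⟦ d′ ⟧
⟦⟧-mono d d′ P→Q = ⟦⟧≤ d (ℕ.≤-reflexive ∘ sym ∘ ⟦⟧-yes d′ ∘ P→Q)

⟦⟧-cong : ∀ {p q} {P : Set p} {Q : Set q} (d : Dec P) (d′ : Dec Q) → (P → Q) → (Q → P) → ⟦ d ⟧ ≡ ⟦ d′ ⟧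
⟦⟧-cong d d′ f g = ℕ.≤-antisym (⟦⟧-mono d d′ f) (⟦⟧-mono d′ d g)

⟦⟧-× : ∀ {p q} {P : Set p} {Q : Set q} (d : Dec P) (d′ : Dec Q) → ⟦ d ×-dec d′ ⟧ ≡ ⟦ d ⟧ * ⟦ d′ ⟧
⟦⟧-× (yes _) (yes _) = refl
⟦⟧-× (yes _) (no _)  = refl
⟦⟧-× (no _)  _       = refl

sum-mono : ∀ {n} {f g : Fin n → ℕ} → (∀ i → f i ≤ g i) → sum f ≤ sum g
sum-mono {zero}  f≤g = z≤n
sum-mono {suc n} f≤g = ℕ.+-mono-≤ (f≤g zero) (sum-mono (f≤g ∘ suc))

sum-const : ∀ n c → sum {n} (λ _ → c) ≡ n * c
sum-const zero    c = refl
sum-const (suc n) c = cong (c +_) (sum-const n c)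

sum-≤-const : ∀ {n} {f : Fin n → ℕ} c → (∀ i → f i ≤ c) → sum f ≤ n * c
sum-≤-const {n} c f≤c = ℕ.≤-trans (sum-mono f≤c) (ℕ.≤-reflexive (sum-const n c))

sum-zero : ∀ {n} {f : Fin n → ℕ} → (∀ i → f i ≡ 0) → sum f ≡ 0
sum-zero {n} f≡0 = trans (sum-cong-≗ f≡0) (trans (sum-const n 0) (ℕ.*-zeroʳ n))

sum-*ˡ : ∀ {n} c (f : Fin n → ℕ) → sum (λ i → c * f i) ≡ c * sum f
sum-*ˡ c f = sym (*-distribˡ-sum ℕ.+-*-semiring c f)

sum-*ʳ : ∀ {n} c (f : Fin n → ℕ) → sum (λ i → f i * c) ≡ sum f * c
sum-*ʳ c f = sym (*-distribʳ-sum ℕ.+-*-semiring c f)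

term≤sum : ∀ {n} (f : Fin n → ℕ) i → f i ≤ sum f
term≤sum f zero    = ℕ.m≤m+n _ _
term≤sum f (suc i) = ℕ.m≤n⇒m≤o+n _ (term≤sum (f ∘ suc) i)

sum-select : ∀ {n} (i : Fin n) (f : Fin n → ℕ) → sum (λ j → ⟦ i Fin.≟ j ⟧ * f j) ≡ f i
sum-select {suc n} zero f = begin
  f zero + 0 + sum (λ j → ⟦ zero Fin.≟ suc j ⟧ * f (suc j)) ≡⟨ cong₂ _+_ (ℕ.+-identityʳ (f zero)) (sum-zero {n} λ _ → refl) ⟩
  f zero + 0                                                ≡⟨ ℕ.+-identityʳ (f zero) ⟩
  f zero                                                    ∎
  where open ≡-Reasoning
sum-select (suc i) f = trans
  (sum-cong-≗ λ j → cong (_* f (suc j)) (⟦⟧-cong (suc i Fin.≟ suc j) (i Fin.≟ j) Fin.suc-injective (cong suc)))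
  (sum-select i (f ∘ suc))

sum-≟ : ∀ {n} (i : Fin n) → sum (λ j → ⟦ i Fin.≟ j ⟧) ≡ 1
sum-≟ {n} i = begin
  sum (λ j → ⟦ i Fin.≟ j ⟧)            ≡⟨ sum-cong-≗ {n} (λ j → ℕ.*-identityʳ ⟦ i Fin.≟ j ⟧) ⟨
  sum (λ j → ⟦ i Fin.≟ j ⟧ * 1)        ≡⟨ sum-select i (λ _ → 1) ⟩
  1                                    ∎
  where open ≡-Reasoning

-- Induction on `m`: `sum-remove` splits off the summand at `φ zero`, and `punchOut` turns the rest
-- of `φ` into an injection into one element fewer.
sum-injective : ∀ {m n} {φ : Fin m → Fin n} → Injective _≡_ _≡_ φ → (f : Fin n → ℕ) → sum (f ∘ φ) ≤ sum f
sum-injective {zero}              inj f = z≤n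
sum-injective {suc m} {zero}  {φ} inj f with φ zero
... | ()
sum-injective {suc m} {suc n} {φ} inj f = begin
  f (φ zero) + sum (f ∘ φ ∘ suc)
    ≡⟨ cong (f (φ zero) +_) (sum-cong-≗ λ i → cong f (Fin.punchIn-punchOut (φ0≢ i))) ⟨
  f (φ zero) + sum (f ∘ punchIn (φ zero) ∘ ψ)
    ≤⟨ ℕ.+-monoʳ-≤ (f (φ zero)) (sum-injective {φ = ψ} ψ-inj (f ∘ punchIn (φ zero))) ⟩
  f (φ zero) + sum (f ∘ punchIn (φ zero))
    ≡⟨ sum-remove f ⟨
  sum f ∎
  where
  open ℕ.≤-Reasoning
  φ0≢ : ∀ i → φ zero ≢ φ (suc i)
  φ0≢ i eq = Fin.0≢1+n (inj eq)
  ψ : Fin m → Fin n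
  ψ i = punchOut (φ0≢ i)
  ψ-inj : Injective _≡_ _≡_ ψ
  ψ-inj eq = Fin.suc-injective (inj (Fin.punchOut-injective (φ0≢ _) (φ0≢ _) eq))

sum-↑ : ∀ m {n} (f : Fin (m + n) → ℕ) → sum f ≡ sum (f ∘ (_↑ˡ n)) + sum (f ∘ (m ↑ʳ_))
sum-↑ zero    f = refl
sum-↑ (suc m) f = trans (cong (f zero +_) (sum-↑ m (f ∘ suc))) (sym (ℕ.+-assoc (f zero) _ _))

sum-combine : ∀ m {n} (f : Fin (m * n) → ℕ) → sum f ≡ sum {m} λ i → sum {n} λ j → f (combine i j)
sum-combine zero        f = refl
sum-combine (suc m) {n} f = trans (sum-↑ n f) (cong (sum (λ j → f (j ↑ˡ (m * n))) +_) (sum-combine m (f ∘ (n ↑ʳ_))))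

sum-remQuot : ∀ m {n} (f : Fin m × Fin n → ℕ) → sum {m * n} (f ∘ remQuot {m} n) ≡ sum λ i → sum λ j → f (i , j)
sum-remQuot m {n} f = trans (sum-combine m (f ∘ remQuot {m} n))
  (sum-cong-≗ λ i → sum-cong-≗ λ j → cong f (Fin.remQuot-combine {m} {n} i j))

-- Off the diagonal every ordered pair is increasing or decreasing; exchanging the two summations
-- transposes the decreasing half onto the increasing one.
sum-unordered : ∀ {n} (f : Fin n → Fin n → ℕ) → (∀ i → f i i ≡ 0) →
  sum (λ i → sum (f i)) ≡ sum λ i → sum λ j → ⟦ i Fin.<? j ⟧ * (f i j + f j i)
sum-unordered f f≡0 = begin
  sum (λ i → sum (f i))
    ≡⟨ sum-cong-≗ (λ i → sum-cong-≗ (split i)) ⟩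
  sum (λ i → sum λ j → up i j + down i j)
    ≡⟨ sum-cong-≗ (λ i → ∑-distrib-+ (up i) (down i)) ⟩
  sum (λ i → sum (up i) + sum (down i))
    ≡⟨ ∑-distrib-+ (sum ∘ up) (sum ∘ down) ⟩
  sum (sum ∘ up) + sum (sum ∘ down)
    ≡⟨ cong (sum (sum ∘ up) +_) (∑-comm down) ⟩
  sum (sum ∘ up) + sum (λ i → sum λ j → down j i)
    ≡⟨ ∑-distrib-+ (sum ∘ up) (λ i → sum λ j → down j i) ⟨
  sum (λ i → sum (up i) + sum λ j → down j i)
    ≡⟨ sum-cong-≗ (λ i → ∑-distrib-+ (up i) (λ j → down j i)) ⟨
  sum (λ i → sum λ j → up i j + down j i)
    ≡⟨ sum-cong-≗ (λ i → sum-cong-≗ λ j → ℕ.*-distribˡ-+ ⟦ i Fin.<? j ⟧ (f i j) (f j i)) ⟨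
  sum (λ i → sum λ j → ⟦ i Fin.<? j ⟧ * (f i j + f j i)) ∎
  where
  open ≡-Reasoning
  up down : _ → _ → ℕ
  up   i j = ⟦ i Fin.<? j ⟧ * f i j
  down i j = ⟦ j Fin.<? i ⟧ * f i j
  split : ∀ i j → f i j ≡ up i j + down i j
  split i j with Fin.<-cmp i j
  ... | tri< i<j _ ¬j<i rewrite ⟦⟧-yes (i Fin.<? j) i<j | ⟦⟧-no (j Fin.<? i) ¬j<i = sym (trans (ℕ.+-identityʳ _) (ℕ.+-identityʳ _))
  ... | tri> ¬i<j _ j<i rewrite ⟦⟧-no (i Fin.<? j) ¬i<j | ⟦⟧-yes (j Fin.<? i) j<i = sym (ℕ.+-identityʳ _)
  ... | tri≈ _ refl _ rewrite f≡0 i = sym (cong₂ _+_ (ℕ.*-zeroʳ ⟦ i Fin.<? i ⟧) (ℕ.*-zeroʳ ⟦ i Fin.<? i ⟧))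

length-filter-tabulate : ∀ {a p n} {A : Set a} {P : Pred A p} (P? : U.Decidable P) (f : Fin n → A) →
  length (filter P? (List.tabulate f)) ≡ sum λ i → ⟦ P? (f i) ⟧
length-filter-tabulate {n = zero}  P? f = refl
length-filter-tabulate {n = suc n} P? f with P? (f zero)
... | yes _ = cong suc (length-filter-tabulate P? (f ∘ suc))
... | no  _ = length-filter-tabulate P? (f ∘ suc)

length-filter-cartesianProduct : ∀ {a b p m n} {A : Set a} {B : Set b} {P : Pred (A × B) p} (P? : U.Decidable P)
  (f : Fin m → A) (g : Fin n → B) →
  length (filter P? (cartesianProduct (List.tabulate f) (List.tabulate g))) ≡ sum λ i → sum λ j → ⟦ P? (f i , g j) ⟧
length-filter-cartesianProduct {m = zero}  P? f g = refl
length-filter-cartesianProduct {m = suc m} P? f g = begin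
  length (filter P? (List.map (f zero ,_) (List.tabulate g) ++ rest))
    ≡⟨ cong length (List.filter-++ P? (List.map (f zero ,_) (List.tabulate g)) rest) ⟩
  length (filter P? (List.map (f zero ,_) (List.tabulate g)) ++ filter P? rest)
    ≡⟨ List.length-++ (filter P? (List.map (f zero ,_) (List.tabulate g))) ⟩
  length (filter P? (List.map (f zero ,_) (List.tabulate g))) + length (filter P? rest)
    ≡⟨ cong₂ _+_
         (trans (cong (length ∘ filter P?) (List.map-tabulate g (f zero ,_))) (length-filter-tabulate P? ((f zero ,_) ∘ g)))
         (length-filter-cartesianProduct P? (f ∘ suc) g) ⟩
  _ ∎
  where
  open ≡-Reasoning
  rest = cartesianProduct (List.tabulate (f ∘ suc)) (List.tabulate g)

-- Turns a counting sum back into distinct elements. This supplies the large side of a copy of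
-- `K s n`, the list of hubs, and the relabelling of the non-isolated vertices.
record Enumeration {n} (P : Pred (Fin n) 0ℓ) (count : ℕ) : Set where
  field
    elem      : Fin count → Fin n
    injective : Injective _≡_ _≡_ elem
    sound     : ∀ i → P (elem i)
    complete  : ∀ {x} → P x → ∃[ i ] elem i ≡ x

enumerate : ∀ {n} {P : Pred (Fin n) 0ℓ} (P? : U.Decidable P) → Enumeration P (sum λ i → ⟦ P? i ⟧)
enumerate {zero}  P? = record { elem = λ () ; injective = λ {} ; sound = λ () ; complete = λ { {()} } }
enumerate {suc n} {P} P? = extend (P? zero)
  where
  open Enumeration (enumerate (P? ∘ suc))
  extend : (d : Dec (P zero)) → Enumeration P (⟦ d ⟧ + sum λ i → ⟦ P? (suc i) ⟧)
  extend (yes p) = record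
    { elem      = λ { zero → zero ; (suc i) → suc (elem i) }
    ; injective = λ { {zero} {zero} _ → refl ; {suc _} {suc _} eq → cong suc (injective (Fin.suc-injective eq)) }
    ; sound     = λ { zero → p ; (suc i) → sound i }
    ; complete  = λ { {zero} _ → zero , refl ; {suc x} px → let i , eq = complete px in suc i , cong suc eq }
    }
  extend (no ¬p) = record
    { elem      = suc ∘ elem
    ; injective = λ eq → injective (Fin.suc-injective eq)
    ; sound     = sound
    ; complete  = λ { {zero} p → contradiction p ¬p ; {suc x} px → let i , eq = complete px in i , cong suc eq }
    }

-- Falling factorials and edge counts

fall : ℕ → ℕ → ℕ
fall b zero    = 1
fall b (suc s) = b * fall (pred b) s

-- In terms of injections into a set with one extra point: either the point is missed, or one of the
-- `suc s` arguments goes there and the others avoid it.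
fall-pascal : ∀ b s → fall (suc b) (suc s) ≡ fall b (suc s) + suc s * fall b s
fall-pascal b       zero    = base b
  where
  base : ∀ b → suc b * 1 ≡ b * 1 + 1 * 1
  base = solve-∀
fall-pascal zero    (suc s) = sym (ℕ.*-zeroʳ (2 + s))
fall-pascal (suc c) (suc t) = begin
  F + suc c * F                                        ≡⟨ cong (λ z → F + suc c * z) (fall-pascal c t) ⟩
  F + suc c * (fall c (suc t) + suc t * fall c t)      ≡⟨ rearrange F (suc c) (fall c (suc t)) (suc t) (fall c t) ⟩
  suc c * fall c (suc t) + (F + suc t * F)             ∎
  where
  open ≡-Reasoning
  F = fall (suc c) (suc t)
  rearrange : ∀ f c x t y → f + c * (x + t * y) ≡ c * x + (f + t * (c * y))
  rearrange = solve-∀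

-- Splits off the last factor `b − s` instead of the first; the subtracted term is moved to the left
-- so that nothing is truncated.
fall-last : ∀ b s → fall b (suc s) + s * fall b s ≡ b * fall b s
fall-last b s = ℕ.+-cancelˡ-≡ (fall b s) _ _ (begin
  fall b s + (fall b (suc s) + s * fall b s)  ≡⟨ swap (fall b s) (fall b (suc s)) (s * fall b s) ⟩
  fall b (suc s) + (fall b s + s * fall b s)  ≡⟨ fall-pascal b s ⟨
  fall b s + b * fall b s                     ∎)
  where
  open ≡-Reasoning
  swap : ∀ x y z → x + (y + z) ≡ y + (x + z)
  swap = solve-∀

fall-mono : ∀ {b c} s → b ≤ c → fall b s ≤ fall c s
fall-mono zero    b≤c = ℕ.≤-refl
fall-mono {b} {c} (suc s) b≤c = ℕ.*-mono-≤ {b} {c} b≤c (fall-mono s (ℕ.pred-mono-≤ b≤c))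

fall>0 : ∀ {b s} → s ≤ b → 1 ≤ fall b s
fall>0 z≤n       = ℕ.≤-refl
fall>0 {suc b} (s≤s s≤b) = ℕ.*-mono-≤ {1} {suc b} (s≤s z≤n) (fall>0 s≤b)

fall-zero : ∀ {b s} → b < s → fall b s ≡ 0
fall-zero {zero}          (s≤s _)   = refl
fall-zero {suc b} {suc s} (s≤s b<s) = trans (cong (suc b *_) (fall-zero b<s)) (ℕ.*-zeroʳ (suc b))

fall≡!*C : ∀ b s → fall b s ≡ s ! * (b C s)
fall≡!*C b zero = sym (trans (ℕ.*-identityˡ (b C 0)) (trans (nCk≡nC[n∸k] {k = 0} {n = b} z≤n) (nCn≡1 b)))
fall≡!*C zero    (suc s) = sym (trans (cong (suc s ! *_) (k>n⇒nCk≡0 {0} {suc s} (s≤s z≤n))) (ℕ.*-zeroʳ (suc s !)))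
fall≡!*C (suc b) (suc s) = begin
  fall (suc b) (suc s)                                  ≡⟨ fall-pascal b s ⟩
  fall b (suc s) + suc s * fall b s                     ≡⟨ cong₂ (λ x y → x + suc s * y) (fall≡!*C b (suc s)) (fall≡!*C b s) ⟩
  suc s * s ! * (b C suc s) + suc s * (s ! * (b C s))   ≡⟨ rearrange (suc s) (s !) (b C suc s) (b C s) ⟩
  suc s ! * ((b C s) + (b C suc s))                     ≡⟨ cong (suc s ! *_) (nCk+nC[k+1]≡[n+1]C[k+1] b s) ⟩
  suc s ! * (suc b C suc s)                             ∎
  where
  open ≡-Reasoning
  rearrange : ∀ t f x y → t * f * x + t * (f * y) ≡ t * f * (y + x)
  rearrange = solve-∀

-- Convexity of `fall _ s`, written without subtraction: by `fall-pascal` each unit increment is a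
-- multiple of a lower falling factorial, hence monotone in the base.
fall-exchange : ∀ {x y} s j → x ≤ y → fall (x + j) s + fall y s ≤ fall x s + fall (y + j) s
fall-exchange zero    j x≤y = ℕ.≤-refl
fall-exchange {x} {y} (suc s) zero x≤y
  rewrite ℕ.+-identityʳ x | ℕ.+-identityʳ y = ℕ.≤-refl
fall-exchange {x} {y} (suc s) (suc j) x≤y
  rewrite ℕ.+-suc x j | ℕ.+-suc y j = begin
  fall (suc (x + j)) (suc s) + fall y (suc s)
    ≡⟨ cong (_+ fall y (suc s)) (fall-pascal (x + j) s) ⟩
  fall (x + j) (suc s) + suc s * fall (x + j) s + fall y (suc s)
    ≡⟨ swap (fall (x + j) (suc s)) (suc s * fall (x + j) s) (fall y (suc s)) ⟩
  fall (x + j) (suc s) + fall y (suc s) + suc s * fall (x + j) s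
    ≤⟨ ℕ.+-mono-≤ (fall-exchange (suc s) j x≤y) (ℕ.*-monoʳ-≤ (suc s) (fall-mono s (ℕ.+-monoˡ-≤ j x≤y))) ⟩
  fall x (suc s) + fall (y + j) (suc s) + suc s * fall (y + j) s
    ≡⟨ ℕ.+-assoc (fall x (suc s)) _ _ ⟩
  fall x (suc s) + (fall (y + j) (suc s) + suc s * fall (y + j) s)
    ≡⟨ cong (fall x (suc s) +_) (fall-pascal (y + j) s) ⟨
  fall x (suc s) + fall (suc (y + j)) (suc s) ∎
  where
  open ℕ.≤-Reasoning
  swap : ∀ x y z → x + y + z ≡ x + z + y
  swap = solve-∀

halves : ℕ → ℕ → ℕ
halves t s = fall ⌊ t /2⌋ s + fall ⌈ t /2⌉ s

⌈n/2⌉≤1+⌊n/2⌋ : ∀ n → ⌈ n /2⌉ ≤ suc ⌊ n /2⌋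
⌈n/2⌉≤1+⌊n/2⌋ zero          = z≤n
⌈n/2⌉≤1+⌊n/2⌋ (suc zero)    = ℕ.≤-refl
⌈n/2⌉≤1+⌊n/2⌋ (suc (suc n)) = s≤s (⌈n/2⌉≤1+⌊n/2⌋ n)

-- By convexity the balanced split is the cheapest. If `p` lies below the floor by `u ∸ p`,
-- `fall-exchange` moves this deficit onto the ceiling, which then still does not exceed `q`.
halves-minimal : ∀ {t p q} s → t ≤ p + q → halves t s ≤ fall p s + fall q s
halves-minimal {t} {p} {q} s t≤p+q = cases (p ℕ.≤? ⌊ t /2⌋) (q ℕ.≤? ⌊ t /2⌋)
  where
  below : ∀ p q → t ≤ p + q → p ≤ ⌊ t /2⌋ → halves t s ≤ fall p s + fall q s
  below p q t≤p+q p≤u = begin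
    fall u s + fall v s              ≡⟨ cong (λ z → fall z s + fall v s) (ℕ.m+[n∸m]≡n p≤u) ⟨
    fall (p + (u ∸ p)) s + fall v s  ≤⟨ fall-exchange s (u ∸ p) (ℕ.≤-trans p≤u (ℕ.⌊n/2⌋≤⌈n/2⌉ t)) ⟩
    fall p s + fall (v + (u ∸ p)) s  ≤⟨ ℕ.+-monoʳ-≤ (fall p s) (fall-mono s rest) ⟩
    fall p s + fall q s              ∎
    where
    open ℕ.≤-Reasoning
    u = ⌊ t /2⌋
    v = ⌈ t /2⌉
    swap : ∀ x y z → x + (y + z) ≡ x + z + y
    swap = solve-∀
    rest : v + (u ∸ p) ≤ q
    rest = ℕ.+-cancelˡ-≤ p _ _ (begin
      p + (v + (u ∸ p))  ≡⟨ swap p v (u ∸ p) ⟩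
      p + (u ∸ p) + v    ≡⟨ cong (_+ v) (ℕ.m+[n∸m]≡n p≤u) ⟩
      u + v              ≡⟨ ℕ.⌊n/2⌋+⌈n/2⌉≡n t ⟩
      t                  ≤⟨ t≤p+q ⟩
      p + q              ∎)
  cases : Dec (p ≤ ⌊ t /2⌋) → Dec (q ≤ ⌊ t /2⌋) → halves t s ≤ fall p s + fall q s
  cases (yes p≤u) _         = below p q t≤p+q p≤u
  cases (no _)    (yes q≤u) =
    subst (halves t s ≤_) (ℕ.+-comm (fall q s) _) (below q p (subst (t ≤_) (ℕ.+-comm p q) t≤p+q) q≤u)
  -- Both parts exceed the floor, so `q` is at least floor plus one and hence at least the ceiling:
  -- the comparison is termwise.
  cases (no p≰u)  (no q≰u)  = ℕ.+-mono-≤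
    (fall-mono s (ℕ.<⇒≤ (ℕ.≰⇒> p≰u)))
    (fall-mono s (ℕ.≤-trans (⌈n/2⌉≤1+⌊n/2⌋ t) (ℕ.≰⇒> q≰u)))

module _ (G : Graph) where
  open Graph G

  degree : Fin order → ℕ
  degree u = sum λ v → ⟦ u ~? v ⟧

  private
    edge? : ∀ u v → Dec (u Fin.< v × u ~ v)
    edge? u v = (u Fin.<? v) ×-dec (u ~? v)

  e≡ : e G ≡ sum λ u → sum λ v → ⟦ edge? u v ⟧
  e≡ = length-filter-cartesianProduct (uncurry edge?) id id

  handshake : sum degree ≡ 2 * e G
  handshake = begin
    sum (λ u → sum λ v → ⟦ u ~? v ⟧)
      ≡⟨ sum-unordered (λ u v → ⟦ u ~? v ⟧) (λ u → ⟦⟧-no (u ~? u) (~-irrefl refl)) ⟩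
    sum (λ u → sum λ v → ⟦ u Fin.<? v ⟧ * (⟦ u ~? v ⟧ + ⟦ v ~? u ⟧))
      ≡⟨ sum-cong-≗ (λ u → sum-cong-≗ (pointwise u)) ⟩
    sum (λ u → sum λ v → 2 * ⟦ edge? u v ⟧)
      ≡⟨ sum-cong-≗ (λ u → sum-*ˡ 2 (λ v → ⟦ edge? u v ⟧)) ⟩
    sum (λ u → 2 * sum λ v → ⟦ edge? u v ⟧)
      ≡⟨ sum-*ˡ 2 (λ u → sum λ v → ⟦ edge? u v ⟧) ⟩
    2 * sum (λ u → sum λ v → ⟦ edge? u v ⟧)
      ≡⟨ cong (2 *_) e≡ ⟨
    2 * e G ∎
    where
    open ≡-Reasoning
    pointwise : ∀ u v → ⟦ u Fin.<? v ⟧ * (⟦ u ~? v ⟧ + ⟦ v ~? u ⟧) ≡ 2 * ⟦ edge? u v ⟧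
    pointwise u v rewrite ⟦⟧-× (u Fin.<? v) (u ~? v) | ⟦⟧-cong (v ~? u) (u ~? v) ~-sym ~-sym =
      double ⟦ u Fin.<? v ⟧ ⟦ u ~? v ⟧
      where
      double : ∀ x y → x * (y + y) ≡ 2 * (x * y)
      double = solve-∀

  -- An asymmetric relation uses at most one direction of each edge, so the factor 2 of `handshake`
  -- does not appear. It serves for the edges directed from non-hubs to hubs.
  orientation≤e : {_⇀_ : Fin order → Fin order → Set} (_⇀?_ : ∀ u v → Dec (u ⇀ v)) →
    (∀ {u v} → u ⇀ v → u ~ v) → (∀ {u v} → u ⇀ v → ¬ (v ⇀ u)) →
    sum (λ u → sum λ v → ⟦ u ⇀? v ⟧) ≤ e G
  orientation≤e {_⇀_} _⇀?_ ⇀⇒~ asym = begin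
    sum (λ u → sum λ v → ⟦ u ⇀? v ⟧)
      ≡⟨ sum-unordered (λ u v → ⟦ u ⇀? v ⟧) (λ u → ⟦⟧-no (u ⇀? u) λ p → asym p p) ⟩
    sum (λ u → sum λ v → ⟦ u Fin.<? v ⟧ * (⟦ u ⇀? v ⟧ + ⟦ v ⇀? u ⟧))
      ≤⟨ sum-mono (λ u → sum-mono (pointwise u)) ⟩
    sum (λ u → sum λ v → ⟦ edge? u v ⟧)
      ≡⟨ e≡ ⟨
    e G ∎
    where
    open ℕ.≤-Reasoning
    pointwise : ∀ u v → ⟦ u Fin.<? v ⟧ * (⟦ u ⇀? v ⟧ + ⟦ v ⇀? u ⟧) ≤ ⟦ edge? u v ⟧
    pointwise u v rewrite ⟦⟧-× (u Fin.<? v) (u ~? v) = ℕ.*-monoʳ-≤ ⟦ u Fin.<? v ⟧ atMostOne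
      where
      atMostOne : ⟦ u ⇀? v ⟧ + ⟦ v ⇀? u ⟧ ≤ ⟦ u ~? v ⟧
      atMostOne with u ⇀? v | v ⇀? u
      ... | yes p | yes q = contradiction q (asym p)
      ... | yes p | no _  = ℕ.≤-reflexive (sym (⟦⟧-yes (u ~? v) (⇀⇒~ p)))
      ... | no _  | yes q = ℕ.≤-reflexive (sym (⟦⟧-yes (u ~? v) (~-sym (⇀⇒~ q))))
      ... | no _  | no _  = z≤n

-- Existence of the size Ramsey number

least : ∀ {p} {P : Pred ℕ p} → U.Decidable P → ∀ m → P m → ∃[ k ] IsLeast _≤_ P k
least P? m p with P? 0
least P? m       p | yes p₀ = 0 , p₀ , λ _ _ → z≤n
least P? zero    p | no ¬p₀ = contradiction p ¬p₀
least P? (suc m) p | no ¬p₀ with least (P? ∘ suc) m p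
... | k , pk , k≤ = suc k , pk , λ { zero p₀ → contradiction p₀ ¬p₀ ; (suc x) px → s≤s (k≤ x px) }

module _ {m n r : ℕ} where

  -- Two-place functions are coded as numbers so that `Fin.any?` and `Fin.all?` can search through
  -- all of them; decoding is inverse to encoding pointwise, without function extensionality.
  decode : Fin ((r ^ n) ^ m) → Fin m → Fin n → Fin r
  decode c i = finToFun (finToFun c i)

  encode : (Fin m → Fin n → Fin r) → Fin ((r ^ n) ^ m)
  encode χ = funToFin λ i → funToFin (χ i)

  decode-encode : ∀ χ i j → decode (encode χ) i j ≡ χ i j
  decode-encode χ i j = trans
    (cong (λ c → finToFun c j) (Fin.finToFun-funToFin (λ i → funToFin (χ i)) i))
    (Fin.finToFun-funToFin (χ i) j)

copy? : ∀ G H → Dec (G ContainsCopyOf H)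
copy? G H = map′ toCopy fromCopy (Fin.any? λ c → embedding? (finToFun c))
  where
  module G = Graph G
  module H = Graph H
  IsEmbedding : (Fin H.order → Fin G.order) → Set
  IsEmbedding φ = ∀ u v → (φ u ≡ φ v → u ≡ v) × (u H.~ v → φ u G.~ φ v)
  embedding? : ∀ φ → Dec (IsEmbedding φ)
  embedding? φ = Fin.all? λ u → Fin.all? λ v →
    ((φ u Fin.≟ φ v) →-dec (u Fin.≟ v)) ×-dec ((u H.~? v) →-dec (φ u G.~? φ v))
  toCopy : ∃[ c ] IsEmbedding (finToFun c) → G ContainsCopyOf H
  toCopy (c , emb) = record
    { embed     = finToFun c
    ; injective = λ {u} {v} → proj₁ (emb u v)
    ; preserves = λ {u} {v} → proj₂ (emb u v)
    }
  fromCopy : G ContainsCopyOf H → ∃[ c ] IsEmbedding (finToFun c)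
  fromCopy C = funToFin embed , λ u v →
    subst₂ (λ x y → (x ≡ y → u ≡ v) × (u H.~ v → x G.~ y))
      (sym (Fin.finToFun-funToFin embed u)) (sym (Fin.finToFun-funToFin embed v))
      (injective , preserves)
    where open _ContainsCopyOf_ C

-- Reading `χ` only with the smaller vertex first makes the result symmetric for arbitrary `χ`, so
-- every code yields a colouring.
colouringFrom : ∀ G {r} → (Fin (Graph.order G) → Fin (Graph.order G) → Fin r) → EdgeColouring G r
colouringFrom G {r} χ = record
  { colour     = λ {u} {v} _ → pick u v
  ; colour-sym = λ {u} {v} p _ → pick-sym u v λ { refl → ~-irrefl refl p }
  }
  where
  open Graph G
  pick : Fin order → Fin order → Fin r
  pick u v = if does (u Fin.<? v) then χ u v else χ v u
  pick-sym : ∀ u v → u ≢ v → pick u v ≡ pick v u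
  pick-sym u v u≢v with Fin.<-cmp u v
  ... | tri< u<v _ v≮u rewrite dec-true (u Fin.<? v) u<v | dec-false (v Fin.<? u) v≮u = refl
  ... | tri> u≮v _ v<u rewrite dec-false (u Fin.<? v) u≮v | dec-true (v Fin.<? u) v<u = refl
  ... | tri≈ _ u≡v _ = contradiction u≡v u≢v

-- A colour does not depend on the proof of adjacency, so each colouring agrees on all edges with a
-- coded one, and copies carry over. Non-adjacent pairs get the default colour `zero`.
⟶? : ∀ {r} G (Hs : Vector Graph (suc r)) → Dec (G ⟶ Hs)
⟶? {r} G Hs = map′ fromCodes (λ G⟶Hs c → G⟶Hs (coded c)) (Fin.all? λ c → Fin.any? λ i → copy? (colourClass (coded c) i) (Hs i))
  where
  open Graph G
  coded : Fin ((suc r ^ order) ^ order) → EdgeColouring G (suc r)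
  coded c = colouringFrom G (decode c)
  fromCodes : (∀ c → ∃[ i ] colourClass (coded c) i ContainsCopyOf Hs i) → G ⟶ Hs
  fromCodes arrows c = i , record
    { embed     = embed
    ; injective = injective
    ; preserves = λ x~y → let p , eq = preserves x~y in p , trans (sym (agree p)) eq
    }
    where
    open EdgeColouring c
    χ : Fin order → Fin order → Fin (suc r)
    χ u v with u ~? v
    ... | yes p = colour p
    ... | no  _ = zero
    χ≡colour : ∀ {u v} (p : u ~ v) → χ u v ≡ colour p
    χ≡colour {u} {v} p with u ~? v
    ... | yes q = trans (colour-sym q (~-sym q)) (sym (colour-sym p (~-sym q)))
    ... | no ¬p = contradiction p ¬p
    agree : ∀ {u v} (p : u ~ v) → EdgeColouring.colour (coded (encode χ)) p ≡ colour p
    agree {u} {v} p with does (u Fin.<? v)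
    ... | true  = trans (decode-encode χ u v) (χ≡colour p)
    ... | false = trans (decode-encode χ v u) (trans (χ≡colour (~-sym p)) (sym (colour-sym p (~-sym p))))
    i = proj₁ (arrows (encode χ))
    open _ContainsCopyOf_ (proj₂ (arrows (encode χ)))

-- Deleting isolated vertices

NoIsolatedVertices : Graph → Set
NoIsolatedVertices H = ∀ u → ∃[ v ] u ~ v
  where open Graph H

-- G′ is obtained from G by deleting isolated vertices and relabelling.
record Reduction (G G′ : Graph) : Set where
  private
    module G = Graph G
    module G′ = Graph G′
  field
    φ         : Fin G′.order → Fin G.order
    injective : Injective _≡_ _≡_ φ
    ~⇒        : ∀ {i j} → i G′.~ j → φ i G.~ φ j
    ~⇐        : ∀ {i j} → φ i G.~ φ j → i G′.~ j
    covers    : ∀ {u v} → u G.~ v → ∃[ i ] φ i ≡ u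

module _ {G G′ : Graph} (R : Reduction G G′) where
  open Reduction R
  private
    module G = Graph G
    module G′ = Graph G′

  -- The edge list refers to the order of the vertices, which `φ` is not assumed to respect; degree
  -- sums are insensitive to it.
  reduction-e : e G′ ≤ e G
  reduction-e = ℕ.*-cancelˡ-≤ 2 (begin
    2 * e G′                                           ≡⟨ handshake G′ ⟨
    sum (λ i → sum λ j → ⟦ i G′.~? j ⟧)                ≡⟨ sum-cong-≗ (λ i → sum-cong-≗ λ j → ⟦⟧-cong (i G′.~? j) (φ i G.~? φ j) ~⇒ ~⇐) ⟩
    sum (λ i → sum λ j → ⟦ φ i G.~? φ j ⟧)             ≤⟨ sum-mono (λ i → sum-injective injective (λ v → ⟦ φ i G.~? v ⟧)) ⟩
    sum (λ i → degree G (φ i))                         ≤⟨ sum-injective injective (degree G) ⟩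
    sum (degree G)                                     ≡⟨ handshake G ⟩
    2 * e G                                            ∎)
    where open ℕ.≤-Reasoning

  -- Colour `G` by transporting the colouring of `G′` along `φ`. Every vertex of the copy found in
  -- `G` has a neighbour there, because `Hs k` has no isolated vertices, so by `covers` it comes
  -- from `G′`.
  reduction-⟶ : ∀ {r} {Hs : Vector Graph r} → (∀ i → NoIsolatedVertices (Hs i)) → G ⟶ Hs → G′ ⟶ Hs
  reduction-⟶ {r} {Hs} noIso G⟶Hs c′ = k , record
    { embed     = λ x → proj₁ (vertex x)
    ; injective = λ {x} {y} eq → C.injective (trans (sym (proj₂ (vertex x))) (trans (cong φ eq) (proj₂ (vertex y))))
    ; preserves = preserves′
    }
    where
    open EdgeColouring c′

    colour-unique : ∀ {i j i′ j′} (p : i G′.~ j) (q : i′ G′.~ j′) → φ i ≡ φ i′ → φ j ≡ φ j′ → colour p ≡ colour q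
    colour-unique p q eq₁ eq₂ with injective eq₁ | injective eq₂
    ... | refl | refl = trans (colour-sym p (G′.~-sym p)) (sym (colour-sym q (G′.~-sym p)))

    lift : ∀ {u v} (p : u G.~ v) → proj₁ (covers p) G′.~ proj₁ (covers (G.~-sym p))
    lift p = ~⇐ (subst₂ G._~_ (sym (proj₂ (covers p))) (sym (proj₂ (covers (G.~-sym p)))) p)

    c : EdgeColouring G r
    c = record
      { colour     = λ p → colour (lift p)
      ; colour-sym = λ p q → trans
          (colour-sym (lift p) (G′.~-sym (lift p)))
          (colour-unique (G′.~-sym (lift p)) (lift q)
            (trans (proj₂ (covers (G.~-sym p))) (sym (proj₂ (covers q))))
            (trans (proj₂ (covers p)) (sym (proj₂ (covers (G.~-sym q))))))
      }

    k = proj₁ (G⟶Hs c)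
    module C = _ContainsCopyOf_ (proj₂ (G⟶Hs c))
    module H = Graph (Hs k)

    vertex : ∀ x → ∃[ i ] φ i ≡ C.embed x
    vertex x = covers (proj₁ (C.preserves (proj₂ (noIso k x))))

    preserves′ : ∀ {x y} → x H.~ y → ∃[ p ] colour {proj₁ (vertex x)} {proj₁ (vertex y)} p ≡ k
    preserves′ {x} {y} x~y =
      let p , eq = C.preserves x~y
          p′ = ~⇐ (subst₂ G._~_ (sym (proj₂ (vertex x))) (sym (proj₂ (vertex y))) p)
      in p′ , trans
        (colour-unique p′ (lift p)
          (trans (proj₂ (vertex x)) (sym (proj₂ (covers p))))
          (trans (proj₂ (vertex y)) (sym (proj₂ (covers (G.~-sym p))))))
        eq

-- Distinctness and both directions are demanded, so that every code, however asymmetric, describes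
-- a graph.
codedGraph : ∀ k → Fin ((2 ^ k) ^ k) → Graph
codedGraph k c = record
  { order    = k
  ; _~_      = λ u v → (u ≢ v) × (decode c u v ≡ suc zero × decode c v u ≡ suc zero)
  ; _~?_     = λ u v → ¬? (u Fin.≟ v) ×-dec ((decode c u v Fin.≟ suc zero) ×-dec (decode c v u Fin.≟ suc zero))
  ; ~-sym    = λ (u≢v , p , q) → (u≢v ∘ sym) , q , p
  ; ~-irrefl = λ u≡v (u≢v , _) → u≢v u≡v
  }

-- Each non-isolated vertex contributes at least 1 to the degree sum `2 * e G`; this bounds the
-- order of the graphs to be searched.
reduce : ∀ G → ∃[ k ] ∃[ c ] k ≤ 2 * e G × Reduction G (codedGraph k c)
reduce G = k , encode χ , k≤2e , record
  { φ         = elem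
  ; injective = injective
  ; ~⇒        = λ {i} {j} (_ , p , _) → bit-yes⁻¹ (elem i ~? elem j) (trans (sym (decode-encode χ i j)) p)
  ; ~⇐        = λ {i} {j} p →
      (λ { refl → ~-irrefl refl p }) , trans (decode-encode χ i j) (bit-yes (elem i ~? elem j) p) ,
      trans (decode-encode χ j i) (bit-yes (elem j ~? elem i) (~-sym p))
  ; covers    = λ {u} {v} p → complete (ℕ.≤-trans (ℕ.≤-reflexive (sym (⟦⟧-yes (u ~? v) p))) (term≤sum (λ v → ⟦ u ~? v ⟧) v))
  }
  where
  open Graph G
  nonIsolated? : U.Decidable (λ u → 1 ≤ degree G u)
  nonIsolated? u = 1 ℕ.≤? degree G u
  open Enumeration (enumerate nonIsolated?)
  k = sum λ u → ⟦ nonIsolated? u ⟧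
  χ : Fin k → Fin k → Fin 2
  χ i j = bit (elem i ~? elem j)
  k≤2e : k ≤ 2 * e G
  k≤2e = ℕ.≤-trans (sum-mono λ u → ⟦⟧≤ (nonIsolated? u) id) (ℕ.≤-reflexive (handshake G))

module _ {r} (Hs : Vector Graph (suc r)) (noIso : ∀ i → NoIsolatedVertices (Hs i)) where

  -- The inequality makes the property stable under `reduction-e` and thus decidable by a finite
  -- search. At the least such `m` the witness has exactly `m` edges.
  Arrows≤ : ℕ → Set₁
  Arrows≤ m = Σ[ G ∈ Graph ] (e G ≤ m × G ⟶ Hs)

  arrows≤? : U.Decidable Arrows≤
  arrows≤? m = map′
    (λ (k , c , e≤m , arrows) → codedGraph (toℕ k) c , e≤m , arrows)
    fromGraph
    (Fin.any? λ (k : Fin (suc (2 * m))) → Fin.any? λ c →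
      (e (codedGraph (toℕ k) c) ℕ.≤? m) ×-dec ⟶? (codedGraph (toℕ k) c) Hs)
    where
    Coded : ℕ → Set
    Coded k = ∃[ c ] e (codedGraph k c) ≤ m × codedGraph k c ⟶ Hs
    fromGraph : Arrows≤ m → ∃[ k ] Coded (toℕ {suc (2 * m)} k)
    fromGraph (G , e≤m , G⟶Hs) =
      let k , c , k≤2e , R = reduce G
          k<1+2m = s≤s (ℕ.≤-trans k≤2e (ℕ.*-monoʳ-≤ 2 e≤m))
      in fromℕ< k<1+2m , subst Coded (sym (Fin.toℕ-fromℕ< k<1+2m))
           (c , ℕ.≤-trans (reduction-e R) e≤m , reduction-⟶ R noIso G⟶Hs)

  sizeRamseyNumber-exists : ∀ G → G ⟶ Hs → ∃[ r̂ ] IsSizeRamseyNumber Hs r̂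
  sizeRamseyNumber-exists G G⟶Hs with least arrows≤? (e G) (G , ℕ.≤-refl , G⟶Hs)
  ... | r̂ , (G₀ , e≤r̂ , G₀⟶Hs) , r̂≤ =
    r̂ , (G₀ , ℕ.≤-antisym e≤r̂ (r̂≤ (e G₀) (G₀ , ℕ.≤-refl , G₀⟶Hs)) , G₀⟶Hs) ,
    λ { _ (G′ , refl , G′⟶Hs) → r̂≤ (e G′) (G′ , ℕ.≤-refl , G′⟶Hs) }

-- Upper bound

-- The sum over all injections of `Fin s` into `Fin a`: the first value is `y`, and `punchIn y` lets
-- the remaining ones avoid it. The recursion runs parallel to that of `fall a s`.
∑inj : ∀ s a → ((Fin s → Fin a) → ℕ) → ℕ
∑inj zero    a       g = g λ ()
∑inj (suc s) zero    g = 0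
∑inj (suc s) (suc a) g = sum λ y → ∑inj s a λ l → g (y ∷ (punchIn y ∘ l))

∷-punchIn-injective : ∀ {s a} y {l : Fin s → Fin a} → Injective _≡_ _≡_ l → Injective _≡_ _≡_ (y ∷ (punchIn y ∘ l))
∷-punchIn-injective y inj {zero}  {zero}  eq = refl
∷-punchIn-injective y inj {zero}  {suc j} eq = contradiction (sym eq) (Fin.punchInᵢ≢i y _)
∷-punchIn-injective y inj {suc i} {zero}  eq = contradiction eq (Fin.punchInᵢ≢i y _)
∷-punchIn-injective y inj {suc i} {suc j} eq = cong suc (inj (Fin.punchIn-injective y _ _ eq))

∑inj-≤ : ∀ s a {g} B → (∀ l → Injective _≡_ _≡_ l → g l ≤ B) → ∑inj s a g ≤ fall a s * B
∑inj-≤ zero    a       B g≤B = ℕ.≤-trans (g≤B (λ ()) λ {}) (ℕ.≤-reflexive (sym (ℕ.+-identityʳ B)))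
∑inj-≤ (suc s) zero    B g≤B = z≤n
∑inj-≤ (suc s) (suc a) {g} B g≤B = begin
  sum (λ y → ∑inj s a λ l → g (y ∷ (punchIn y ∘ l)))
    ≤⟨ sum-≤-const (fall a s * B) (λ y → ∑inj-≤ s a B λ l inj → g≤B _ (∷-punchIn-injective y inj)) ⟩
  suc a * (fall a s * B)
    ≡⟨ ℕ.*-assoc (suc a) (fall a s) B ⟨
  suc a * fall a s * B ∎
  where open ℕ.≤-Reasoning

∑inj-cong : ∀ s a {g h} → (∀ l → g l ≡ h l) → ∑inj s a g ≡ ∑inj s a h
∑inj-cong zero    a       g≡h = g≡h _
∑inj-cong (suc s) zero    g≡h = refl
∑inj-cong (suc s) (suc a) g≡h = sum-cong-≗ {suc a} λ y → ∑inj-cong s a λ l → g≡h (y ∷ (punchIn y ∘ l))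

∑inj-*ˡ : ∀ s a c g → ∑inj s a (λ l → c * g l) ≡ c * ∑inj s a g
∑inj-*ˡ zero    a       c g = refl
∑inj-*ˡ (suc s) zero    c g = sym (ℕ.*-zeroʳ c)
∑inj-*ˡ (suc s) (suc a) c g = trans
  (sum-cong-≗ {suc a} λ y → ∑inj-*ˡ s a c λ l → g (y ∷ (punchIn y ∘ l)))
  (sum-*ˡ c λ y → ∑inj s a λ l → g (y ∷ (punchIn y ∘ l)))

∑inj-sum : ∀ s a {m} (g : Fin m → (Fin s → Fin a) → ℕ) →
  sum (λ x → ∑inj s a (g x)) ≡ ∑inj s a λ l → sum λ x → g x l
∑inj-sum zero    a           g = refl
∑inj-sum (suc s) zero    {m} g = sum-zero {m} λ _ → refl
∑inj-sum (suc s) (suc a)     g = trans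
  (∑-comm λ x y → ∑inj s a λ l → g x (y ∷ (punchIn y ∘ l)))
  (sum-cong-≗ {suc a} λ y → ∑inj-sum s a λ x l → g x (y ∷ (punchIn y ∘ l)))

-- Counts the injections into the set `P`: once a first value in `P` is chosen, one element of `P`
-- fewer is available.
∑inj-into : ∀ s a {P : Pred (Fin a) 0ℓ} (P? : U.Decidable P) →
  ∑inj s a (λ l → ⟦ Fin.all? (P? ∘ l) ⟧) ≡ fall (sum λ y → ⟦ P? y ⟧) s
∑inj-into zero    a       P? = refl
∑inj-into (suc s) zero    P? = refl
∑inj-into (suc s) (suc a) {P} P? = begin
  sum (λ y → ∑inj s a λ l → ⟦ Fin.all? (P? ∘ (y ∷ (punchIn y ∘ l))) ⟧)
    ≡⟨ sum-cong-≗ (λ y → trans (∑inj-cong s a (first y)) (∑inj-*ˡ s a ⟦ P? y ⟧ _)) ⟩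
  sum (λ y → ⟦ P? y ⟧ * ∑inj s a λ l → ⟦ Fin.all? (P? ∘ punchIn y ∘ l) ⟧)
    ≡⟨ sum-cong-≗ (λ y → cong (⟦ P? y ⟧ *_) (∑inj-into s a (P? ∘ punchIn y))) ⟩
  sum (λ y → ⟦ P? y ⟧ * fall (sum λ z → ⟦ P? (punchIn y z) ⟧) s)
    ≡⟨ sum-cong-≗ rest ⟩
  sum (λ y → ⟦ P? y ⟧ * fall (pred total) s)
    ≡⟨ sum-*ʳ (fall (pred total) s) (λ y → ⟦ P? y ⟧) ⟩
  total * fall (pred total) s ∎
  where
  open ≡-Reasoning
  total = sum λ y → ⟦ P? y ⟧
  first : ∀ y l → ⟦ Fin.all? (P? ∘ (y ∷ (punchIn y ∘ l))) ⟧ ≡ ⟦ P? y ⟧ * ⟦ Fin.all? (P? ∘ punchIn y ∘ l) ⟧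
  first y l = trans
    (⟦⟧-cong (Fin.all? (P? ∘ (y ∷ (punchIn y ∘ l)))) (P? y ×-dec Fin.all? (P? ∘ punchIn y ∘ l))
      (λ p → p zero , p ∘ suc)
      (λ { (p , _) zero → p ; (_ , p) (suc i) → p i }))
    (⟦⟧-× (P? y) (Fin.all? (P? ∘ punchIn y ∘ l)))
  -- For `y` outside `P` the two falling factorials may differ, but the factor 0 hides this.
  rest : ∀ y → ⟦ P? y ⟧ * fall (sum λ z → ⟦ P? (punchIn y z) ⟧) s ≡ ⟦ P? y ⟧ * fall (pred total) s
  rest y with P? y in eq
  ... | no  _ = refl
  ... | yes _ = cong (λ t → 1 * fall t s)
    (sym (cong pred (trans (sum-remove {i = y} (λ y → ⟦ P? y ⟧)) (cong (_+ others) (cong ⟦_⟧ eq)))))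
    where others = sum λ z → ⟦ P? (punchIn y z) ⟧

module _ {s n : ℕ} where

  splitAt-injective : ∀ {u v : Fin (s + n)} → splitAt s u ≡ splitAt s v → u ≡ v
  splitAt-injective {u} {v} eq = trans (sym (Fin.join-splitAt s n u)) (trans (cong (Fin.join s n) eq) (Fin.join-splitAt s n v))

  K-adjacent : ∀ p q → Graph._~_ (K s n) (p ↑ˡ n) (s ↑ʳ q)
  K-adjacent p q = subst₂ Opposite (sym (Fin.splitAt-↑ˡ s p n)) (sym (Fin.splitAt-↑ʳ s n q)) left-right

module _ {G : Graph} {s n : ℕ} where
  open Graph G

  -- Injectivity on each side suffices: a vertex shared by the two sides would be adjacent to
  -- itself.
  copyOfK : {L : Fin s → Fin order} {R : Fin n → Fin order} → Injective _≡_ _≡_ L → Injective _≡_ _≡_ R →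
    (∀ p q → L p ~ R q) → G ContainsCopyOf K s n
  copyOfK {L} {R} L-inj R-inj adj = record
    { embed     = [ L , R ]′ ∘ splitAt s
    ; injective = λ eq → splitAt-injective (sides eq)
    ; preserves = λ {u} {v} → edge (splitAt s u) (splitAt s v)
    }
    where
    sides : ∀ {x y} → [ L , R ]′ x ≡ [ L , R ]′ y → x ≡ y
    sides {inj₁ p} {inj₁ p′} eq = cong inj₁ (L-inj eq)
    sides {inj₂ q} {inj₂ q′} eq = cong inj₂ (R-inj eq)
    sides {inj₁ p} {inj₂ q}  eq = contradiction (adj p q) (~-irrefl eq)
    sides {inj₂ q} {inj₁ p}  eq = contradiction (adj p q) (~-irrefl (sym eq))
    edge : ∀ x y → Opposite x y → [ L , R ]′ x ~ [ L , R ]′ y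
    edge _ _ (left-right {p} {q}) = adj p q
    edge _ _ (right-left {p} {q}) = ~-sym (adj p q)

e-K : ∀ a m → e (K a m) ≤ a * m
e-K a m = ℕ.*-cancelˡ-≤ 2 (begin
  2 * e (K a m)
    ≡⟨ handshake (K a m) ⟨
  sum (degree (K a m))
    ≡⟨ sum-↑ a (degree (K a m)) ⟩
  sum (λ p → degree (K a m) (p ↑ˡ m)) + sum (λ q → degree (K a m) (a ↑ʳ q))
    ≤⟨ ℕ.+-mono-≤ (sum-≤-const m left) (sum-≤-const a right) ⟩
  a * m + m * a
    ≡⟨ double a m ⟩
  2 * (a * m) ∎)
  where
  open ℕ.≤-Reasoning
  open Graph (K a m)
  double : ∀ a m → a * m + m * a ≡ 2 * (a * m)
  double = solve-∀
  left : ∀ p → degree (K a m) (p ↑ˡ m) ≤ m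
  left p = begin
    degree (K a m) (p ↑ˡ m)
      ≡⟨ sum-↑ a (λ v → ⟦ (p ↑ˡ m) ~? v ⟧) ⟩
    sum (λ p′ → ⟦ (p ↑ˡ m) ~? (p′ ↑ˡ m) ⟧) + sum (λ q → ⟦ (p ↑ˡ m) ~? (a ↑ʳ q) ⟧)
      ≤⟨ ℕ.+-mono-≤ (ℕ.≤-reflexive (sum-zero λ p′ → ⟦⟧-no ((p ↑ˡ m) ~? (p′ ↑ˡ m)) (apart p′)))
                    (sum-≤-const 1 λ q → ⟦⟧≤1 ((p ↑ˡ m) ~? (a ↑ʳ q))) ⟩
    m * 1
      ≡⟨ ℕ.*-identityʳ m ⟩
    m ∎
    where
    apart : ∀ p′ → ¬ ((p ↑ˡ m) ~ (p′ ↑ˡ m))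
    apart p′ adj with subst₂ Opposite (Fin.splitAt-↑ˡ a p m) (Fin.splitAt-↑ˡ a p′ m) adj
    ... | ()
  right : ∀ q → degree (K a m) (a ↑ʳ q) ≤ a
  right q = begin
    degree (K a m) (a ↑ʳ q)
      ≡⟨ sum-↑ a (λ v → ⟦ (a ↑ʳ q) ~? v ⟧) ⟩
    sum (λ p → ⟦ (a ↑ʳ q) ~? (p ↑ˡ m) ⟧) + sum (λ q′ → ⟦ (a ↑ʳ q) ~? (a ↑ʳ q′) ⟧)
      ≤⟨ ℕ.+-mono-≤ (sum-≤-const 1 λ p → ⟦⟧≤1 ((a ↑ʳ q) ~? (p ↑ˡ m)))
                    (ℕ.≤-reflexive (sum-zero λ q′ → ⟦⟧-no ((a ↑ʳ q) ~? (a ↑ʳ q′)) (apart q′))) ⟩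
    a * 1 + 0
      ≡⟨ trans (ℕ.+-identityʳ (a * 1)) (ℕ.*-identityʳ a) ⟩
    a ∎
    where
    apart : ∀ q′ → ¬ ((a ↑ʳ q) ~ (a ↑ʳ q′))
    apart q′ adj with subst₂ Opposite (Fin.splitAt-↑ʳ a m q) (Fin.splitAt-↑ʳ a m q′) adj
    ... | ()

module BipartiteColouring {a m r} (c : EdgeColouring (K a m) r) where
  open EdgeColouring c

  χ : Fin a → Fin m → Fin r
  χ y x = colour (K-adjacent y x)

  colourDegree : Fin r → Fin m → ℕ
  colourDegree i x = sum λ y → ⟦ χ y x Fin.≟ i ⟧

  sum-colourDegree : ∀ x → sum (λ i → colourDegree i x) ≡ a
  sum-colourDegree x = begin
    sum (λ i → sum λ y → ⟦ χ y x Fin.≟ i ⟧)  ≡⟨ ∑-comm (λ i y → ⟦ χ y x Fin.≟ i ⟧) ⟩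
    sum (λ y → sum λ i → ⟦ χ y x Fin.≟ i ⟧)  ≡⟨ sum-cong-≗ (λ y → sum-≟ (χ y x)) ⟩
    sum {a} (λ y → 1)                        ≡⟨ sum-const a 1 ⟩
    a * 1                                    ≡⟨ ℕ.*-identityʳ a ⟩
    a                                        ∎
    where open ≡-Reasoning

  -- Double counting of the monochromatic stars with s leaves on the left.
  stars-bound : ∀ {i s n} → ¬ (colourClass c i ContainsCopyOf K s n) →
    sum (λ x → fall (colourDegree i x) s) ≤ fall a s * n
  stars-bound {i} {s} {n} noCopy = begin
    sum (λ x → fall (colourDegree i x) s)
      ≡⟨ sum-cong-≗ (λ x → ∑inj-into s a (λ y → χ y x Fin.≟ i)) ⟨
    sum (λ x → ∑inj s a λ l → ⟦ star? l x ⟧)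
      ≡⟨ ∑inj-sum s a (λ x l → ⟦ star? l x ⟧) ⟩
    ∑inj s a (λ l → sum λ x → ⟦ star? l x ⟧)
      ≤⟨ ∑inj-≤ s a n (λ l inj → ℕ.≮⇒≥ (tooMany l inj)) ⟩
    fall a s * n ∎
    where
    open ℕ.≤-Reasoning
    star? : ∀ (l : Fin s → Fin a) x → Dec (∀ p → χ (l p) x ≡ i)
    star? l x = Fin.all? λ p → χ (l p) x Fin.≟ i
    tooMany : ∀ l → Injective _≡_ _≡_ l → ¬ (n < sum λ x → ⟦ star? l x ⟧)
    tooMany l inj n< = noCopy (copyOfK
      (inj ∘ Fin.↑ˡ-injective m _ _)
      (λ eq → Fin.inject≤-injective n≤ n≤ _ _ (injective (Fin.↑ʳ-injective a _ _ eq)))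
      λ p q → K-adjacent (l p) (elem (inject≤ q n≤)) , sound (inject≤ q n≤) p)
      where
      open Enumeration (enumerate (star? l))
      n≤ = ℕ.<⇒≤ n<

module Forbidden {k} (s : ℕ) (ss ts : Vector ℕ k) where

  d : ℕ
  d = sum λ i → ss i ∸ 1

  D : ℕ → ℕ
  D a = halves (a ∸ d) s

  Hs : ℕ → Vector Graph (2 + k)
  Hs n = K s n ∷ K s n ∷ λ i → K (ss i) (ts i)

  module _ (a : ℕ) where

    -- In the absence of copies this bounds the number of `x` with `ss i` or more edges of some
    -- colour `suc (suc i)`: each is the centre of a star counted by `stars-bound`.
    exceptions : ℕ
    exceptions = sum λ i → fall a (ss i) * ts i

    -- If there is no copy, each `x` accounts for at least `D a`: an ordinary vertex by
    -- `halves-minimal`, an exceptional one because `F x ≥ 1`. Summing and applying `stars-bound` in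
    -- every colour contradicts the hypothesis.
    K⟶ : ∀ {n m} → 2 * fall a s * n + D a * exceptions < m * D a → K a m ⟶ Hs n
    K⟶ {n} {m} big c with Fin.any? (λ i → copy? (colourClass c i) (Hs n i))
    ... | yes copy  = copy
    ... | no noCopy = contradiction big (ℕ.≤⇒≯ (begin
      m * D a
        ≡⟨ sum-const m (D a) ⟨
      sum {m} (λ _ → D a)
        ≤⟨ sum-mono pointwise ⟩
      sum (λ x → F₁ x + F₂ x + D a * F x)
        ≡⟨ ∑-distrib-+ (λ x → F₁ x + F₂ x) (λ x → D a * F x) ⟩
      sum (λ x → F₁ x + F₂ x) + sum (λ x → D a * F x)
        ≡⟨ cong₂ _+_ (∑-distrib-+ F₁ F₂) (sum-*ˡ (D a) F) ⟩
      sum F₁ + sum F₂ + D a * sum F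
        ≡⟨ cong (λ z → sum F₁ + sum F₂ + D a * z) (∑-comm (λ x i → fall (deg (suc (suc i)) x) (ss i))) ⟩
      sum F₁ + sum F₂ + D a * sum (λ i → sum λ x → fall (deg (suc (suc i)) x) (ss i))
        ≤⟨ ℕ.+-mono-≤
             (ℕ.+-mono-≤ (stars-bound {zero} (noCopy ∘ (zero ,_))) (stars-bound {suc zero} (noCopy ∘ (suc zero ,_))))
             (ℕ.*-monoʳ-≤ (D a) (sum-mono λ i → stars-bound {suc (suc i)} (noCopy ∘ (suc (suc i) ,_)))) ⟩
      fall a s * n + fall a s * n + D a * exceptions
        ≡⟨ cong (_+ D a * exceptions) (double (fall a s) n) ⟩
      2 * fall a s * n + D a * exceptions ∎))
      where
      open ℕ.≤-Reasoning
      open BipartiteColouring c renaming (colourDegree to deg)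
      F₁ F₂ F : Fin m → ℕ
      F₁ x = fall (deg zero x) s
      F₂ x = fall (deg (suc zero) x) s
      F  x = sum λ i → fall (deg (suc (suc i)) x) (ss i)
      double : ∀ x n → x * n + x * n ≡ 2 * x * n
      double = solve-∀
      pointwise : ∀ x → D a ≤ F₁ x + F₂ x + D a * F x
      pointwise x with Fin.any? (λ i → ss i ℕ.≤? deg (suc (suc i)) x)
      ... | yes (i , sᵢ≤) = ℕ.m≤n⇒m≤o+n (F₁ x + F₂ x) (begin
        D a        ≡⟨ ℕ.*-identityʳ (D a) ⟨
        D a * 1    ≤⟨ ℕ.*-monoʳ-≤ (D a) (ℕ.≤-trans (fall>0 sᵢ≤) (term≤sum (λ i → fall (deg (suc (suc i)) x) (ss i)) i)) ⟩
        D a * F x  ∎)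
      ... | no few = ℕ.m≤n⇒m≤n+o (D a * F x) (halves-minimal s (ℕ.m≤n+o⇒m∸n≤o a d (begin
        a
          ≡⟨ sum-colourDegree x ⟨
        deg zero x + (deg (suc zero) x + sum λ i → deg (suc (suc i)) x)
          ≤⟨ ℕ.+-monoʳ-≤ (deg zero x) (ℕ.+-monoʳ-≤ (deg (suc zero) x) (sum-mono λ i →
               ℕ.∸-monoˡ-≤ 1 (ℕ.≰⇒> λ sᵢ≤ → few (i , sᵢ≤)))) ⟩
        deg zero x + (deg (suc zero) x + d)
          ≡⟨ rotate (deg zero x) (deg (suc zero) x) d ⟩
        d + (deg zero x + deg (suc zero) x) ∎)))
        where
        rotate : ∀ x y z → x + (y + z) ≡ z + (x + y)
        rotate = solve-∀

    upper : 1 ≤ D a → ∀ n → Σ[ G ∈ Graph ] (G ⟶ Hs n × D a * e G ≤ a * (2 * fall a s) * n + a * D a * suc exceptions)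
    upper D>0 n = K a m , K⟶ big , (begin
      D a * e (K a m)
        ≤⟨ ℕ.*-monoʳ-≤ (D a) (e-K a m) ⟩
      D a * (a * m)
        ≡⟨ expand (D a) a (X / D a) (suc exceptions) ⟩
      a * (X / D a * D a) + a * D a * suc exceptions
        ≤⟨ ℕ.+-monoˡ-≤ (a * D a * suc exceptions) (ℕ.*-monoʳ-≤ a (m/n*n≤m X (D a))) ⟩
      a * X + a * D a * suc exceptions
        ≡⟨ cong (_+ a * D a * suc exceptions) (ℕ.*-assoc a (2 * fall a s) n) ⟨
      a * (2 * fall a s) * n + a * D a * suc exceptions ∎)
      where
      open ℕ.≤-Reasoning
      instance _ = >-nonZero D>0
      X = 2 * fall a s * n
      -- The extra 1 makes up for rounding `X / D a` down and gives the strict inequality that `K⟶`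
      -- asks for.
      m = X / D a + suc exceptions
      expand : ∀ q a x t → q * (a * (x + t)) ≡ a * (x * q) + a * q * t
      expand = solve-∀
      collect : ∀ q x t → q + x * q + q * t ≡ (x + suc t) * q
      collect = solve-∀
      big : X + D a * exceptions < m * D a
      big = begin-strict
        X + D a * exceptions
          ≡⟨ cong (_+ D a * exceptions) (m≡m%n+[m/n]*n X (D a)) ⟩
        X % D a + X / D a * D a + D a * exceptions
          <⟨ ℕ.+-monoˡ-< (D a * exceptions) (ℕ.+-monoˡ-< (X / D a * D a) (m%n<n X (D a))) ⟩
        D a + X / D a * D a + D a * exceptions
          ≡⟨ collect (D a) (X / D a) exceptions ⟩
        m * D a ∎

-- Urns, permutations and balanced classes

module _ {a} {P : Pred (Fin (suc a)) 0ℓ} (P? : U.Decidable P) where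
  private
    b = sum λ i → ⟦ P? i ⟧
    others : Fin (suc a) → ℕ
    others i = sum λ j → ⟦ P? (punchIn i j) ⟧

    total : ∀ i → ⟦ P? i ⟧ + others i ≡ b
    total i = sym (sum-remove {i = i} (λ i → ⟦ P? i ⟧))

  ⟦⟧*fall-others : ∀ i s → ⟦ P? i ⟧ * fall (others i) s ≡ ⟦ P? i ⟧ * fall (pred b) s
  ⟦⟧*fall-others i s with P? i | total i
  ... | no  _ | _  = refl
  ... | yes _ | eq = cong (λ z → 1 * fall (pred z) s) eq

  -- Double counting of pairs of an injection into `P` and a position `i` that it misses: each
  -- injection misses `suc a − s` positions. The term with `s` is moved to the left to avoid
  -- subtraction.
  sum-fall-others : ∀ s → sum (λ i → fall (others i) s) + s * fall b s ≡ suc a * fall b s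
  sum-fall-others s = ℕ.+-cancelˡ-≡ (fall b (suc s)) _ _ (begin
    fall b (suc s) + (O + s * F)       ≡⟨ swap (fall b (suc s)) O (s * F) ⟩
    O + (fall b (suc s) + s * F)       ≡⟨ cong (O +_) (fall-last b s) ⟩
    O + b * F                          ≡⟨ cong (O +_) (sum-*ʳ F (λ i → ⟦ P? i ⟧)) ⟨
    O + sum (λ i → ⟦ P? i ⟧ * F)       ≡⟨ ∑-distrib-+ (λ i → fall (others i) s) (λ i → ⟦ P? i ⟧ * F) ⟨
    sum (λ i → fall (others i) s + ⟦ P? i ⟧ * F)
                                       ≡⟨ sum-cong-≗ pointwise ⟩
    sum (λ i → ⟦ P? i ⟧ * fall (pred b) s + F)
                                       ≡⟨ ∑-distrib-+ (λ i → ⟦ P? i ⟧ * fall (pred b) s) (λ _ → F) ⟩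
    sum (λ i → ⟦ P? i ⟧ * fall (pred b) s) + sum {suc a} (λ _ → F)
                                       ≡⟨ cong₂ _+_ (sum-*ʳ (fall (pred b) s) (λ i → ⟦ P? i ⟧)) (sum-const (suc a) F) ⟩
    fall b (suc s) + suc a * F         ∎)
    where
    open ≡-Reasoning
    F = fall b s
    O = sum λ i → fall (others i) s
    swap : ∀ x y z → x + (y + z) ≡ y + (x + z)
    swap = solve-∀
    pointwise : ∀ i → fall (others i) s + ⟦ P? i ⟧ * F ≡ ⟦ P? i ⟧ * fall (pred b) s + F
    pointwise i with P? i | total i
    ... | no  _ | eq   = trans (ℕ.+-identityʳ _) (cong (λ z → fall z s) eq)
    ... | yes _ | eq   = cong₂ _+_ (trans (cong (λ z → fall (pred z) s) eq) (sym (ℕ.+-identityʳ _))) (ℕ.+-identityʳ F)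

fall-factorial : ∀ s r → fall (s + r) s * r ! ≡ (s + r) !
fall-factorial zero    r = ℕ.+-identityʳ (r !)
fall-factorial (suc s) r = trans (ℕ.*-assoc (suc (s + r)) (fall (s + r) s) (r !)) (cong (suc (s + r) *_) (fall-factorial s r))

!-mono : ∀ {m n} → m ≤ n → m ! ≤ n !
!-mono {n = n} m≤n = ∣⇒≤ {{n ℕ.!≢0}} (m≤n⇒m!∣n! m≤n)

module _ {r : ℕ} where

  -- The permutation π of the positions in A, read off as the sequence of draws without
  -- replacement from the urn U of coloured balls. Positions outside A get a junk colour.
  draw : ∀ {ℓ} (A : Subset ℓ) (U : Fin ∣ A ∣ → Fin (suc r)) → Fin (∣ A ∣ !) → Fin ℓ → Fin (suc r)
  draw (false ∷ᵛ A) U π zero    = zero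
  draw (false ∷ᵛ A) U π (suc y) = draw A U π y
  draw (true  ∷ᵛ A) U π zero    = U (proj₁ (remQuot {suc ∣ A ∣} (∣ A ∣ !) π))
  draw (true  ∷ᵛ A) U π (suc y) =
    draw A (U ∘ punchIn (proj₁ (remQuot {suc ∣ A ∣} (∣ A ∣ !) π))) (proj₂ (remQuot {suc ∣ A ∣} (∣ A ∣ !) π)) y

  multiplicity : ∀ {a} → (Fin a → Fin (suc r)) → Fin (suc r) → ℕ
  multiplicity U c = sum λ i → ⟦ U i Fin.≟ c ⟧

  draw-multiplicity : ∀ {ℓ} (A : Subset ℓ) U π c →
    sum (λ y → if lookup A y then ⟦ draw A U π y Fin.≟ c ⟧ else 0) ≡ multiplicity U c
  draw-multiplicity []           U π c = refl
  draw-multiplicity (false ∷ᵛ A) U π c = draw-multiplicity A U π c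
  draw-multiplicity (true  ∷ᵛ A) U π c = trans
    (cong (⟦ U i Fin.≟ c ⟧ +_) (draw-multiplicity A (U ∘ punchIn i) _ c))
    (sym (sum-remove {i = i} (λ i → ⟦ U i Fin.≟ c ⟧)))
    where i = proj₁ (remQuot {suc ∣ A ∣} (∣ A ∣ !) π)

  -- The indicator of: S ⊆ A and every position in S draws the colour c.
  hits : ∀ {ℓ} (c : Fin (suc r)) (S A : Subset ℓ) (U : Fin ∣ A ∣ → Fin (suc r)) → Fin (∣ A ∣ !) → ℕ
  hits c []           []           U π = 1
  hits c (false ∷ᵛ S) (false ∷ᵛ A) U π = hits c S A U π
  hits c (true  ∷ᵛ S) (false ∷ᵛ A) U π = 0
  hits c (b     ∷ᵛ S) (true  ∷ᵛ A) U π =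
    (if b then ⟦ U i Fin.≟ c ⟧ else 1) * hits c S A (U ∘ punchIn i) π′
    where
    i = proj₁ (remQuot {suc ∣ A ∣} (∣ A ∣ !) π)
    π′ = proj₂ (remQuot {suc ∣ A ∣} (∣ A ∣ !) π)

  hits-yes : ∀ {ℓ} c (S A : Subset ℓ) U π →
    (∀ y → lookup S y ≡ true → lookup A y ≡ true × draw A U π y ≡ c) → hits c S A U π ≡ 1
  hits-yes c []           []           U π all = refl
  hits-yes c (false ∷ᵛ S) (false ∷ᵛ A) U π all = hits-yes c S A U π (all ∘ suc)
  hits-yes c (true  ∷ᵛ S) (false ∷ᵛ A) U π all with all zero refl
  ... | () , _
  hits-yes c (false ∷ᵛ S) (true  ∷ᵛ A) U π all = trans (ℕ.*-identityˡ _) (hits-yes c S A _ _ (all ∘ suc))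
  hits-yes c (true  ∷ᵛ S) (true  ∷ᵛ A) U π all =
    cong₂ _*_ (⟦⟧-yes (_ Fin.≟ c) (proj₂ (all zero refl))) (hits-yes c S A _ _ (all ∘ suc))

  hits-tooMany : ∀ {ℓ} c (S A : Subset ℓ) U π → ∣ A ∣ < ∣ S ∣ → hits c S A U π ≡ 0
  hits-tooMany c (false ∷ᵛ S) (false ∷ᵛ A) U π lt       = hits-tooMany c S A U π lt
  hits-tooMany c (true  ∷ᵛ S) (false ∷ᵛ A) U π lt       = refl
  hits-tooMany c (false ∷ᵛ S) (true  ∷ᵛ A) U π lt       = trans (ℕ.*-identityˡ _) (hits-tooMany c S A _ _ (ℕ.<⇒≤ lt))
  hits-tooMany c (true  ∷ᵛ S) (true  ∷ᵛ A) U π (s≤s lt) =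
    trans (cong (⟦ U i Fin.≟ c ⟧ *_) (hits-tooMany c S A _ _ lt)) (ℕ.*-zeroʳ ⟦ U i Fin.≟ c ⟧)
    where i = proj₁ (remQuot {suc ∣ A ∣} (∣ A ∣ !) π)

  -- The positions in `S` receive distinct balls of colour `c`, and the remaining `t` balls go to
  -- the other positions in any order. If `S` is not contained in `A`, there are no hits.
  sum-hits : ∀ {ℓ} c (S A : Subset ℓ) U t → ∣ S ∣ + t ≡ ∣ A ∣ →
    sum (hits c S A U) ≤ fall (multiplicity U c) ∣ S ∣ * t !
  sum-hits c []           []           U zero eq = ℕ.≤-refl
  sum-hits c (false ∷ᵛ S) (false ∷ᵛ A) U t    eq = sum-hits c S A U t eq
  sum-hits c (true  ∷ᵛ S) (false ∷ᵛ A) U t    eq = ℕ.≤-trans (ℕ.≤-reflexive (sum-zero {∣ A ∣ !} λ _ → refl)) z≤n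
  sum-hits c (true  ∷ᵛ S) (true  ∷ᵛ A) U t    eq = begin
    sum (hits c (true ∷ᵛ S) (true ∷ᵛ A) U)
      ≡⟨ sum-remQuot (suc ∣ A ∣) (λ (i , π) → ⟦ U i Fin.≟ c ⟧ * hits c S A (U ∘ punchIn i) π) ⟩
    sum (λ i → sum λ π → ⟦ U i Fin.≟ c ⟧ * hits c S A (U ∘ punchIn i) π)
      ≡⟨ sum-cong-≗ (λ i → sum-*ˡ ⟦ U i Fin.≟ c ⟧ (hits c S A (U ∘ punchIn i))) ⟩
    sum (λ i → ⟦ U i Fin.≟ c ⟧ * sum (hits c S A (U ∘ punchIn i)))
      ≤⟨ sum-mono (λ i → ℕ.*-monoʳ-≤ ⟦ U i Fin.≟ c ⟧ (sum-hits c S A (U ∘ punchIn i) t (ℕ.suc-injective eq))) ⟩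
    sum (λ i → ⟦ U i Fin.≟ c ⟧ * (fall (multiplicity (U ∘ punchIn i) c) ∣ S ∣ * t !))
      ≡⟨ sum-cong-≗ (λ i → trans (sym (ℕ.*-assoc ⟦ U i Fin.≟ c ⟧ _ _)) (cong (_* t !) (⟦⟧*fall-others P? i ∣ S ∣))) ⟩
    sum (λ i → ⟦ U i Fin.≟ c ⟧ * fall (pred b) ∣ S ∣ * t !)
      ≡⟨ sum-*ʳ (t !) (λ i → ⟦ U i Fin.≟ c ⟧ * fall (pred b) ∣ S ∣) ⟩
    sum (λ i → ⟦ U i Fin.≟ c ⟧ * fall (pred b) ∣ S ∣) * t !
      ≡⟨ cong (_* t !) (sum-*ʳ (fall (pred b) ∣ S ∣) (λ i → ⟦ U i Fin.≟ c ⟧)) ⟩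
    b * fall (pred b) ∣ S ∣ * t ! ∎
    where
    open ℕ.≤-Reasoning
    b = multiplicity U c
    P? = λ i → U i Fin.≟ c
  sum-hits c (false ∷ᵛ S) (true  ∷ᵛ A) U t    eq = begin
    sum (hits c (false ∷ᵛ S) (true ∷ᵛ A) U)
      ≡⟨ sum-remQuot (suc ∣ A ∣) (λ (i , π) → 1 * hits c S A (U ∘ punchIn i) π) ⟩
    sum (λ i → sum λ π → 1 * hits c S A (U ∘ punchIn i) π)
      ≡⟨ sum-cong-≗ (λ i → sum-cong-≗ λ π → ℕ.*-identityˡ (hits c S A (U ∘ punchIn i) π)) ⟩
    sum (λ i → sum (hits c S A (U ∘ punchIn i)))
      ≤⟨ rest t eq ⟩
    fall b ∣ S ∣ * t ! ∎
    where
    open ℕ.≤-Reasoning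
    b = multiplicity U c
    rest : ∀ t → ∣ S ∣ + t ≡ suc ∣ A ∣ → sum (λ i → sum (hits c S A (U ∘ punchIn i))) ≤ fall b ∣ S ∣ * t !
    -- With `t = 0` a position outside `S` leaves fewer positions than `S` has elements, so every
    -- summand vanishes.
    rest zero    eq = ℕ.≤-trans (ℕ.≤-reflexive (sum-zero {suc ∣ A ∣} λ i → sum-zero {∣ A ∣ !} λ π →
      hits-tooMany c S A (U ∘ punchIn i) π (ℕ.≤-reflexive (trans (sym eq) (ℕ.+-identityʳ ∣ S ∣))))) z≤n
    rest (suc t) eq = begin
      sum (λ i → sum (hits c S A (U ∘ punchIn i)))
        ≤⟨ sum-mono (λ i → sum-hits c S A (U ∘ punchIn i) t (ℕ.suc-injective (trans (sym (ℕ.+-suc ∣ S ∣ t)) eq))) ⟩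
      sum (λ i → fall (multiplicity (U ∘ punchIn i) c) ∣ S ∣ * t !)
        ≡⟨ sum-*ʳ (t !) (λ i → fall (multiplicity (U ∘ punchIn i) c) ∣ S ∣) ⟩
      sum (λ i → fall (multiplicity (U ∘ punchIn i) c) ∣ S ∣) * t !
        ≡⟨ cong (_* t !) others ⟩
      suc t * fall b ∣ S ∣ * t !
        ≡⟨ rotate (suc t) (fall b ∣ S ∣) (t !) ⟩
      fall b ∣ S ∣ * (suc t * t !) ∎
      where
      rotate : ∀ x y z → x * y * z ≡ y * (x * z)
      rotate = solve-∀
      split : ∀ s t f → (s + t) * f ≡ t * f + s * f
      split = solve-∀
      others : sum (λ i → fall (multiplicity (U ∘ punchIn i) c) ∣ S ∣) ≡ suc t * fall b ∣ S ∣
      others = ℕ.+-cancelʳ-≡ (∣ S ∣ * fall b ∣ S ∣) _ _ (trans (sum-fall-others (λ i → U i Fin.≟ c) ∣ S ∣)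
        (trans (cong (_* fall b ∣ S ∣) (sym eq)) (split ∣ S ∣ (suc t) (fall b ∣ S ∣))))

block : ∀ {r} (caps : Vector ℕ r) → Fin (sum caps) → Fin r
block {suc r} caps = [ const zero , suc ∘ block (tail caps) ]′ ∘ splitAt (caps zero)

block-multiplicity : ∀ {r} (caps : Vector ℕ r) c → sum (λ i → ⟦ block caps i Fin.≟ c ⟧) ≡ caps c
block-multiplicity {suc r} caps c = begin
  sum (λ i → ⟦ block caps i Fin.≟ c ⟧)
    ≡⟨ sum-↑ (caps zero) (λ i → ⟦ block caps i Fin.≟ c ⟧) ⟩
  sum (λ i → ⟦ block caps (i ↑ˡ n) Fin.≟ c ⟧) + sum (λ i → ⟦ block caps (caps zero ↑ʳ i) Fin.≟ c ⟧)
    ≡⟨ cong₂ _+_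
         (sum-cong-≗ {caps zero} λ i → cong (λ x → ⟦ side x Fin.≟ c ⟧) (Fin.splitAt-↑ˡ (caps zero) i n))
         (sum-cong-≗ {n} λ i → cong (λ x → ⟦ side x Fin.≟ c ⟧) (Fin.splitAt-↑ʳ (caps zero) n i)) ⟩
  sum {caps zero} (λ _ → ⟦ zero Fin.≟ c ⟧) + sum (λ i → ⟦ suc (block (tail caps) i) Fin.≟ c ⟧)
    ≡⟨ colour c ⟩
  caps c ∎
  where
  open ≡-Reasoning
  n = sum (tail caps)
  side = [ const zero , suc ∘ block (tail caps) ]′
  colour : ∀ c → sum {caps zero} (λ _ → ⟦ zero Fin.≟ c ⟧) + sum (λ i → ⟦ suc (block (tail caps) i) Fin.≟ c ⟧) ≡ caps c
  colour zero    = trans (cong₂ _+_ (trans (sum-const (caps zero) 1) (ℕ.*-identityʳ (caps zero))) (sum-zero {n} λ _ → refl)) (ℕ.+-identityʳ (caps zero))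
  colour (suc c) = trans (cong₂ _+_ (sum-zero {caps zero} λ _ → refl)
    (sum-cong-≗ {n} λ i → ⟦⟧-cong (suc (block (tail caps) i) Fin.≟ suc c) (block (tail caps) i Fin.≟ c) Fin.suc-injective (cong suc)))
    (block-multiplicity (tail caps) c)

-- The capacities may add up to more than `a`, so the first `a` balls of the row are taken; the
-- capacities then bound the multiplicities from above.
urn : ∀ {r a} (caps : Vector ℕ (suc r)) → a ≤ sum caps → Fin a → Fin (suc r)
urn caps a≤ i = block caps (inject≤ i a≤)

urn-multiplicity : ∀ {r a} (caps : Vector ℕ (suc r)) (a≤ : a ≤ sum caps) c → multiplicity (urn caps a≤) c ≤ caps c
urn-multiplicity caps a≤ c = ℕ.≤-trans
  (sum-injective (λ eq → Fin.inject≤-injective a≤ a≤ _ _ eq) (λ i → ⟦ block caps i Fin.≟ c ⟧))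
  (ℕ.≤-reflexive (block-multiplicity caps c))

sum-toℕ-snoc : ∀ n (g : ℕ → ℕ) → sum {suc n} (g ∘ toℕ) ≡ g n + sum {n} (g ∘ toℕ)
sum-toℕ-snoc zero    g = refl
sum-toℕ-snoc (suc n) g = trans (cong (g 0 +_) (sum-toℕ-snoc n (g ∘ suc))) (swap (g 0) (g (suc n)) (sum {n} (g ∘ suc ∘ toℕ)))
  where
  swap : ∀ x y z → x + (y + z) ≡ y + (x + z)
  swap = solve-∀

-- The `w` indices are covered by `w / T + 1` full periods, each contributing `sum h`; completing
-- the last period costs at most `T` further indices.
sum-cyclic : ∀ w T .{{_ : NonZero T}} (h : Fin T → ℕ) → T * sum {w} (λ i → h (toℕ i mod T)) ≤ (w + T) * sum h
sum-cyclic w T h = begin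
  T * sum {w} (λ i → h (toℕ i mod T))
    ≤⟨ ℕ.*-monoʳ-≤ T shorter ⟩
  T * sum {n * T} (λ i → h (toℕ i mod T))
    ≡⟨ cong (T *_) (trans (sum-combine n {T} (λ i → h (toℕ i mod T))) (sum-cong-≗ {n} λ i → sum-cong-≗ {T} λ j → cong h (period i j))) ⟩
  T * sum {n} (λ _ → sum h)
    ≡⟨ cong (T *_) (sum-const n (sum h)) ⟩
  T * (n * sum h)
    ≡⟨ expand T (w / T) (sum h) ⟩
  (w / T * T + T) * sum h
    ≤⟨ ℕ.*-monoˡ-≤ (sum h) (ℕ.+-monoˡ-≤ T (m/n*n≤m w T)) ⟩
  (w + T) * sum h ∎
  where
  open ℕ.≤-Reasoning
  n = suc (w / T)
  expand : ∀ t k x → t * (suc k * x) ≡ (k * t + t) * x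
  expand = solve-∀
  w≤ : w ≤ n * T
  w≤ = ℕ.≤-trans (ℕ.≤-reflexive (m≡m%n+[m/n]*n w T)) (ℕ.+-monoˡ-≤ (w / T * T) (ℕ.<⇒≤ (m%n<n w T)))
  shorter : sum {w} (λ i → h (toℕ i mod T)) ≤ sum {n * T} (λ i → h (toℕ i mod T))
  shorter = ℕ.≤-trans
    (ℕ.≤-reflexive (sum-cong-≗ {w} λ i → cong (λ z → h (z mod T)) (sym (Fin.toℕ-inject≤ i w≤))))
    (sum-injective (λ eq → Fin.inject≤-injective w≤ w≤ _ _ eq) (λ i → h (toℕ i mod T)))
  period : ∀ (i : Fin n) (j : Fin T) → toℕ (combine i j) mod T ≡ j
  period i j = Fin.toℕ-injective (begin-equality
    toℕ (toℕ (combine i j) mod T)  ≡⟨ Fin.toℕ-fromℕ< (m%n<n (toℕ (combine i j)) T) ⟩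
    toℕ (combine i j) % T          ≡⟨ cong (_% T) (trans (Fin.toℕ-combine i j) (trans (ℕ.+-comm (T * toℕ i) (toℕ j)) (cong (toℕ j +_) (ℕ.*-comm T (toℕ i))))) ⟩
    (toℕ j + toℕ i * T) % T        ≡⟨ [m+kn]%n≡m%n (toℕ j) (toℕ i) T ⟩
    toℕ j % T                      ≡⟨ m<n⇒m%n≡m (Fin.toℕ<n j) ⟩
    toℕ j                          ∎)

module _ {Q : ℕ} where

  classSize : ∀ {N} → (Fin N → Fin Q) → Fin Q → ℕ
  classSize τ q = sum λ x → ⟦ τ x Fin.≟ q ⟧

  -- The position of x in its class, counted from the end.
  rank : ∀ {N} → (Fin N → Fin Q) → Fin N → ℕ
  rank τ zero    = classSize (τ ∘ suc) (τ zero)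
  rank τ (suc x) = rank (τ ∘ suc) x

  -- Along a class of size `w` the ranks are `w − 1`, ..., `0`, once each. The head of the class has
  -- the largest rank, which is the term split off by `sum-toℕ-snoc`.
  sum-rank : ∀ {N} (τ : Fin N → Fin Q) q (g : ℕ → ℕ) →
    sum (λ x → ⟦ τ x Fin.≟ q ⟧ * g (rank τ x)) ≡ sum {classSize τ q} (g ∘ toℕ)
  sum-rank {zero}  τ q g = refl
  sum-rank {suc N} τ q g with τ zero Fin.≟ q
  ... | no _     = sum-rank (τ ∘ suc) q g
  ... | yes refl = trans
    (cong₂ _+_ (ℕ.+-identityʳ (g (classSize (τ ∘ suc) q))) (sum-rank (τ ∘ suc) q g))
    (sym (sum-toℕ-snoc (classSize (τ ∘ suc) q) g))

  rank-balanced : ∀ {N} (τ : Fin N → Fin Q) q T .{{_ : NonZero T}} (h : Fin T → ℕ) →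
    T * sum (λ x → ⟦ τ x Fin.≟ q ⟧ * h (rank τ x mod T)) ≤ (classSize τ q + T) * sum h
  rank-balanced τ q T h = ℕ.≤-trans
    (ℕ.≤-reflexive (cong (T *_) (sum-rank τ q (λ i → h (i mod T)))))
    (sum-cyclic (classSize τ q) T h)

-- Lower bound

∣tabulate∣ : ∀ {n} (f : Fin n → Bool) → ∣ tabulate f ∣ ≡ sum λ i → if f i then 1 else 0
∣tabulate∣ {zero}  f = refl
∣tabulate∣ {suc n} f with f zero
... | true  = cong suc (∣tabulate∣ (f ∘ suc))
... | false = ∣tabulate∣ (f ∘ suc)

lookup-tabulate-does : ∀ {n p} {P : Pred (Fin n) p} (P? : U.Decidable P) {i} →
  P i → lookup (tabulate (does ∘ P?)) i ≡ true
lookup-tabulate-does P? {i} p = trans (lookup∘tabulate (does ∘ P?) i) (dec-true (P? i) p)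

image : ∀ {s ℓ} → (Fin s → Fin ℓ) → Subset ℓ
image l = tabulate λ i → does (Fin.any? λ p → l p Fin.≟ i)

∈-image⁻ : ∀ {s ℓ} (l : Fin s → Fin ℓ) i → lookup (image l) i ≡ true → ∃[ p ] l p ≡ i
∈-image⁻ l i eq with Fin.any? (λ p → l p Fin.≟ i) | trans (sym (lookup∘tabulate (λ i → does (Fin.any? λ p → l p Fin.≟ i)) i)) eq
... | yes hit | _ = hit

∣image∣ : ∀ {s ℓ} {l : Fin s → Fin ℓ} → Injective _≡_ _≡_ l → ∣ image l ∣ ≡ s
∣image∣ {s} {ℓ} {l} inj = trans (∣tabulate∣ (does ∘ hit?)) (ℕ.≤-antisym below above)
  where
  open ℕ.≤-Reasoning
  hit? : ∀ i → Dec (∃[ p ] l p ≡ i)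
  hit? i = Fin.any? λ p → l p Fin.≟ i
  below : sum (λ i → ⟦ hit? i ⟧) ≤ s
  below = begin
    sum (λ i → ⟦ hit? i ⟧)
      ≤⟨ sum-mono (λ i → ⟦⟧≤ (hit? i) λ (p , eq) →
           ℕ.≤-trans (ℕ.≤-reflexive (sym (⟦⟧-yes (l p Fin.≟ i) eq))) (term≤sum (λ p → ⟦ l p Fin.≟ i ⟧) p)) ⟩
    sum (λ i → sum λ p → ⟦ l p Fin.≟ i ⟧)  ≡⟨ ∑-comm (λ i p → ⟦ l p Fin.≟ i ⟧) ⟩
    sum (λ p → sum λ i → ⟦ l p Fin.≟ i ⟧)  ≡⟨ sum-cong-≗ (λ p → sum-≟ (l p)) ⟩
    sum {s} (λ _ → 1)                      ≡⟨ trans (sum-const s 1) (ℕ.*-identityʳ s) ⟩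
    s                                      ∎
  above : s ≤ sum (λ i → ⟦ hit? i ⟧)
  above = begin
    s                              ≡⟨ trans (sum-const s 1) (ℕ.*-identityʳ s) ⟨
    sum {s} (λ _ → 1)              ≡⟨ sum-cong-≗ {s} (λ p → ⟦⟧-yes (hit? (l p)) (p , refl)) ⟨
    sum (λ p → ⟦ hit? (l p) ⟧)     ≤⟨ sum-injective inj (λ i → ⟦ hit? i ⟧) ⟩
    sum (λ i → ⟦ hit? i ⟧)         ∎

-- P / Q plays the role of the minimum μ: `optimal` says that P / Q ≤ a · f(a), and is
-- vacuous when a ≤ σ, where D a = 0.
module LowerBound {k} (s : ℕ) (ss ts : Vector ℕ k) (P Q : ℕ)
  (optimal : ∀ a → P * Forbidden.D s ss ts a ≤ Q * (a * (2 * fall a s))) where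

  open Forbidden s ss ts

  caps : Fin 2 → ℕ → Vector ℕ (2 + k)
  caps zero       a = ⌊ a ∸ d /2⌋ ∷ ⌈ a ∸ d /2⌉ ∷ λ i → ss i ∸ 1
  caps (suc zero) a = ⌈ a ∸ d /2⌉ ∷ ⌊ a ∸ d /2⌋ ∷ λ i → ss i ∸ 1

  caps-sum : ∀ b a → a ≤ sum (caps b a)
  caps-sum zero       a = begin
    a                                               ≤⟨ ℕ.m≤n+m∸n a d ⟩
    d + (a ∸ d)                                     ≡⟨ cong (d +_) (ℕ.⌊n/2⌋+⌈n/2⌉≡n (a ∸ d)) ⟨
    d + (⌊ a ∸ d /2⌋ + ⌈ a ∸ d /2⌉)                 ≡⟨ rotate d ⌊ a ∸ d /2⌋ ⌈ a ∸ d /2⌉ ⟩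
    ⌊ a ∸ d /2⌋ + (⌈ a ∸ d /2⌉ + d)                 ∎
    where
    open ℕ.≤-Reasoning
    rotate : ∀ x y z → x + (y + z) ≡ y + (z + x)
    rotate = solve-∀
  caps-sum (suc zero) a = ℕ.≤-trans (caps-sum zero a) (ℕ.≤-reflexive (swap ⌊ a ∸ d /2⌋ ⌈ a ∸ d /2⌉ d))
    where
    swap : ∀ x y z → x + (y + z) ≡ y + (x + z)
    swap = solve-∀

  caps-rest : ∀ b a i → caps b a (suc (suc i)) ≡ ss i ∸ 1
  caps-rest zero       a i = refl
  caps-rest (suc zero) a i = refl

  -- The first two colours trade floor and ceiling between the two urns, so over both urns together
  -- each of them has the same total.
  Halved : Fin (2 + k) → Set
  Halved c = ∀ a → sum (λ b → fall (caps b a c) s) ≡ D a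

  halved-first : Halved zero
  halved-first a = cong (fall ⌊ a ∸ d /2⌋ s +_) (ℕ.+-identityʳ _)

  halved-second : Halved (suc zero)
  halved-second a = trans (cong (fall ⌈ a ∸ d /2⌉ s +_) (ℕ.+-identityʳ _)) (ℕ.+-comm (fall ⌈ a ∸ d /2⌉ s) _)

  module _ {ℓ} (A : Subset ℓ) where

    -- A pattern is a choice of one of the two urns together with an order of drawing from it.
    patterns : ℕ
    patterns = 2 * ∣ A ∣ !

    patterns-nonZero : NonZero patterns
    patterns-nonZero = ℕ.m*n≢0 2 (∣ A ∣ !) {{_}} {{∣ A ∣ ℕ.!≢0}}

    urns : Fin 2 → Fin ∣ A ∣ → Fin (2 + k)
    urns b = urn (caps b ∣ A ∣) (caps-sum b ∣ A ∣)

    pattern-draw : Fin patterns → Fin ℓ → Fin (2 + k)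
    pattern-draw j = draw A (urns (proj₁ (remQuot {2} (∣ A ∣ !) j))) (proj₂ (remQuot {2} (∣ A ∣ !) j))

    pattern-hits : Fin (2 + k) → Subset ℓ → Fin patterns → ℕ
    pattern-hits c S j = hits c S A (urns (proj₁ (remQuot {2} (∣ A ∣ !) j))) (proj₂ (remQuot {2} (∣ A ∣ !) j))

    -- With `a = ∣ A ∣` and `t = a − s`, at most `D a * t !` of the `2 * a !` patterns hit `S`, a
    -- fraction `1 / f(a)`; `optimal` bounds it by `Q * a / P`. For `a < s` there are no hits.
    sum-pattern-hits : ∀ {c} S → Halved c → ∣ S ∣ ≡ s → P * sum (pattern-hits c S) ≤ Q * (∣ A ∣ * patterns)
    sum-pattern-hits {c} S halved refl with s ℕ.≤? ∣ A ∣
    ... | no s≰a = begin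
      P * sum (pattern-hits c S)  ≡⟨ cong (P *_) (sum-zero {patterns} λ j → hits-tooMany c S A _ _ (ℕ.≰⇒> s≰a)) ⟩
      P * 0                       ≡⟨ ℕ.*-zeroʳ P ⟩
      0                           ≤⟨ z≤n ⟩
      Q * (∣ A ∣ * patterns)      ∎
      where open ℕ.≤-Reasoning
    ... | yes s≤a = begin
      P * sum (pattern-hits c S)
        ≡⟨ cong (P *_) (sum-remQuot 2 (λ (b , π) → hits c S A (urns b) π)) ⟩
      P * sum (λ b → sum (hits c S A (urns b)))
        ≤⟨ ℕ.*-monoʳ-≤ P (sum-mono λ b → ℕ.≤-trans (sum-hits c S A (urns b) t s+t≡a)
             (ℕ.*-monoˡ-≤ (t !) (fall-mono s (urn-multiplicity (caps b ∣ A ∣) (caps-sum b ∣ A ∣) c)))) ⟩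
      P * sum (λ b → fall (caps b ∣ A ∣ c) s * t !)
        ≡⟨ cong (P *_) (trans (sum-*ʳ (t !) (λ b → fall (caps b ∣ A ∣ c) s)) (cong (_* t !) (halved ∣ A ∣))) ⟩
      P * (D ∣ A ∣ * t !)
        ≡⟨ ℕ.*-assoc P (D ∣ A ∣) (t !) ⟨
      P * D ∣ A ∣ * t !
        ≤⟨ ℕ.*-monoˡ-≤ (t !) (optimal ∣ A ∣) ⟩
      Q * (∣ A ∣ * (2 * fall ∣ A ∣ s)) * t !
        ≡⟨ regroup Q ∣ A ∣ (fall ∣ A ∣ s) (t !) ⟩
      Q * (∣ A ∣ * (2 * (fall ∣ A ∣ s * t !)))
        ≡⟨ cong (λ z → Q * (∣ A ∣ * (2 * z))) factorial ⟩
      Q * (∣ A ∣ * patterns) ∎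
      where
      open ℕ.≤-Reasoning
      t = ∣ A ∣ ∸ s
      s+t≡a : s + t ≡ ∣ A ∣
      s+t≡a = ℕ.m+[n∸m]≡n s≤a
      factorial : fall ∣ A ∣ s * t ! ≡ ∣ A ∣ !
      factorial = subst (λ a → fall a s * t ! ≡ a !) s+t≡a (fall-factorial s t)
      regroup : ∀ q a f t → q * (a * (2 * f)) * t ≡ q * (a * (2 * (f * t)))
      regroup = solve-∀

  module Construction (G : Graph) {ℓ} {hub : Fin ℓ → Fin (Graph.order G)} (hub-injective : Injective _≡_ _≡_ hub) where
    open Graph G

    IsHub : Fin order → Set
    IsHub v = ∃[ i ] hub i ≡ v

    isHub? : U.Decidable IsHub
    isHub? v = Fin.any? λ i → hub i Fin.≟ v

    _▷_ : Fin order → Fin ℓ → Set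
    x ▷ i = ¬ IsHub x × x ~ hub i

    _▷?_ : ∀ x i → Dec (x ▷ i)
    x ▷? i = ¬? (isHub? x) ×-dec (x ~? hub i)

    -- Sets of hubs are coded as numbers below `2 ^ ℓ`, so that one can sum over all groups of
    -- vertices.
    typeSet : Fin (2 ^ ℓ) → Subset ℓ
    typeSet q = tabulate λ i → does (finToFun {2} {ℓ} q i Fin.≟ suc zero)

    τ : Fin order → Fin (2 ^ ℓ)
    τ x = funToFin λ i → bit (x ▷? i)

    τ-bit⇒ : ∀ {x i} → x ▷ i → finToFun {2} {ℓ} (τ x) i ≡ suc zero
    τ-bit⇒ {x} {i} p = trans (Fin.finToFun-funToFin {ℓ} {2} (λ i → bit (x ▷? i)) i) (bit-yes (x ▷? i) p)

    τ-bit⇐ : ∀ {x i} → finToFun {2} {ℓ} (τ x) i ≡ suc zero → x ▷ i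
    τ-bit⇐ {x} {i} eq = bit-yes⁻¹ (x ▷? i) (trans (sym (Fin.finToFun-funToFin {ℓ} {2} (λ i → bit (x ▷? i)) i)) eq)

    ▷⇒∈typeSet : ∀ {x i} → x ▷ i → lookup (typeSet (τ x)) i ≡ true
    ▷⇒∈typeSet {x} p = lookup-tabulate-does (λ i → finToFun {2} {ℓ} (τ x) i Fin.≟ suc zero) (τ-bit⇒ p)

    ∣typeSet∣ : ∀ x → ∣ typeSet (τ x) ∣ ≡ sum λ i → ⟦ x ▷? i ⟧
    ∣typeSet∣ x = trans (∣tabulate∣ λ i → does (finToFun {2} {ℓ} (τ x) i Fin.≟ suc zero))
      (sum-cong-≗ {ℓ} λ i → ⟦⟧-cong (finToFun {2} {ℓ} (τ x) i Fin.≟ suc zero) (x ▷? i) τ-bit⇐ τ-bit⇒)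

    -- The edges between a non-hub and a hub, directed towards the hub, form an asymmetric relation,
    -- so `orientation≤e` applies.
    sum-∣typeSet∣ : sum (λ x → ∣ typeSet (τ x) ∣) ≤ e G
    sum-∣typeSet∣ = begin
      sum (λ x → ∣ typeSet (τ x) ∣)          ≡⟨ sum-cong-≗ ∣typeSet∣ ⟩
      sum (λ x → sum λ i → ⟦ x ▷? i ⟧)       ≤⟨ sum-mono (λ x → sum-mono λ i → ⟦⟧-mono (x ▷? i) (x ⇀? hub i) λ (¬h , adj) → ¬h , (i , refl) , adj) ⟩
      sum (λ x → sum λ i → ⟦ x ⇀? hub i ⟧)   ≤⟨ sum-mono (λ x → sum-injective hub-injective (λ y → ⟦ x ⇀? y ⟧)) ⟩
      sum (λ x → sum λ y → ⟦ x ⇀? y ⟧)       ≤⟨ orientation≤e G _⇀?_ (λ (_ , _ , adj) → adj) (λ (¬h , _) (_ , h , _) → ¬h h) ⟩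
      e G                                    ∎
      where
      open ℕ.≤-Reasoning
      _⇀?_ : ∀ x y → Dec (¬ IsHub x × IsHub y × x ~ y)
      x ⇀? y = ¬? (isHub? x) ×-dec (isHub? y ×-dec (x ~? y))

    -- Defined for every type `q`, not only for `τ x`, so that `sum-select` can replace `τ x` by a
    -- sum over `q`.
    choice : ∀ q → Fin order → Fin (patterns (typeSet q))
    choice q x = _mod_ (rank τ x) (patterns (typeSet q)) {{patterns-nonZero (typeSet q)}}

    κ : Fin order → Fin ℓ → Fin (2 + k)
    κ x = pattern-draw (typeSet (τ x)) (choice (τ x) x)

    starHits : Fin (2 + k) → Subset ℓ → Fin order → ℕ
    starHits c S x = pattern-hits (typeSet (τ x)) c S (choice (τ x) x)

    -- The cost of the incomplete last rounds: each of the `2 ^ ℓ` groups adds at most one full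
    -- round of its patterns, weighted by the size of its hub set.
    overhead : ℕ
    overhead = 2 ^ ℓ * (2 * ℓ ! * ℓ)

    -- Split by type. Within a group of `w` vertices, `rank-balanced` and `sum-pattern-hits` bound
    -- `P` times the hits by `Q` times `(w + T) * a`; the terms `w * a` add up to at most `e G`, the
    -- terms `T * a` to at most `overhead`.
    starHits-bound : ∀ {c} S → Halved c → ∣ S ∣ ≡ s → P * sum (starHits c S) ≤ Q * (e G + overhead)
    starHits-bound {c} S halved ∣S∣≡s = begin
      P * sum (starHits c S)
        ≡⟨ cong (P *_) (sum-cong-≗ (λ x → sum-select (τ x) (λ q → pattern-hits (typeSet q) c S (choice q x)))) ⟨
      P * sum (λ x → sum λ q → part q x)
        ≡⟨ cong (P *_) (∑-comm (λ x q → part q x)) ⟩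
      P * sum (λ q → sum (part q))
        ≡⟨ sum-*ˡ P (λ q → sum (part q)) ⟨
      sum (λ q → P * sum (part q))
        ≤⟨ sum-mono perType ⟩
      sum (λ q → Q * ((classSize τ q + T q) * a q))
        ≡⟨ sum-*ˡ Q (λ q → (classSize τ q + T q) * a q) ⟩
      Q * sum (λ q → (classSize τ q + T q) * a q)
        ≡⟨ cong (Q *_) (trans (sum-cong-≗ λ q → ℕ.*-distribʳ-+ (a q) (classSize τ q) (T q))
             (∑-distrib-+ (λ q → classSize τ q * a q) (λ q → T q * a q))) ⟩
      Q * (sum (λ q → classSize τ q * a q) + sum (λ q → T q * a q))
        ≤⟨ ℕ.*-monoʳ-≤ Q (ℕ.+-mono-≤ edgesUsed (sum-≤-const (2 * ℓ ! * ℓ) λ q →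
             ℕ.*-mono-≤ (ℕ.*-monoʳ-≤ 2 (!-mono (∣p∣≤n (typeSet q)))) (∣p∣≤n (typeSet q)))) ⟩
      Q * (e G + overhead) ∎
      where
      open ℕ.≤-Reasoning
      T a : Fin (2 ^ ℓ) → ℕ
      T q = patterns (typeSet q)
      a q = ∣ typeSet q ∣
      part : Fin (2 ^ ℓ) → Fin order → ℕ
      part q x = ⟦ τ x Fin.≟ q ⟧ * pattern-hits (typeSet q) c S (choice q x)
      swap : ∀ x y z → x * (y * z) ≡ y * (x * z)
      swap = solve-∀
      regroup : ∀ w t q a → (w + t) * (q * (a * t)) ≡ t * (q * ((w + t) * a))
      regroup = solve-∀
      perType : ∀ q → P * sum (part q) ≤ Q * ((classSize τ q + T q) * a q)
      perType q = ℕ.*-cancelˡ-≤ (T q) {{patterns-nonZero (typeSet q)}} (begin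
        T q * (P * sum (part q))
          ≡⟨ swap (T q) P (sum (part q)) ⟩
        P * (T q * sum (part q))
          ≤⟨ ℕ.*-monoʳ-≤ P (rank-balanced τ q (T q) {{patterns-nonZero (typeSet q)}} (pattern-hits (typeSet q) c S)) ⟩
        P * ((classSize τ q + T q) * sum (pattern-hits (typeSet q) c S))
          ≡⟨ swap P (classSize τ q + T q) _ ⟩
        (classSize τ q + T q) * (P * sum (pattern-hits (typeSet q) c S))
          ≤⟨ ℕ.*-monoʳ-≤ (classSize τ q + T q) (sum-pattern-hits (typeSet q) S halved ∣S∣≡s) ⟩
        (classSize τ q + T q) * (Q * (a q * T q))
          ≡⟨ regroup (classSize τ q) (T q) Q (a q) ⟩
        T q * (Q * ((classSize τ q + T q) * a q)) ∎)
      edgesUsed : sum (λ q → classSize τ q * a q) ≤ e G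
      edgesUsed = begin
        sum (λ q → classSize τ q * a q)              ≡⟨ sum-cong-≗ (λ q → sum-*ʳ (a q) (λ x → ⟦ τ x Fin.≟ q ⟧)) ⟨
        sum (λ q → sum λ x → ⟦ τ x Fin.≟ q ⟧ * a q)  ≡⟨ ∑-comm (λ q x → ⟦ τ x Fin.≟ q ⟧ * a q) ⟩
        sum (λ x → sum λ q → ⟦ τ x Fin.≟ q ⟧ * a q)  ≡⟨ sum-cong-≗ (λ x → sum-select (τ x) a) ⟩
        sum (λ x → a (τ x))                          ≤⟨ sum-∣typeSet∣ ⟩
        e G                                          ∎

    -- Giving the first colour to all other edges is harmless: in a K s n it accounts for at most
    -- ℓ vertices of the n-side, as the s-side consists of hubs.
    paint : ∀ u v → Dec (IsHub u) → Dec (IsHub v) → Fin (2 + k)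
    paint u v (no _)        (yes (i , _)) = κ u i
    paint u v (yes (i , _)) (no _)        = κ v i
    paint u v _             _             = zero

    paint-sym : ∀ u v hu hv → paint u v hu hv ≡ paint v u hv hu
    paint-sym u v (no _)  (yes _) = refl
    paint-sym u v (yes _) (no _)  = refl
    paint-sym u v (no _)  (no _)  = refl
    paint-sym u v (yes _) (yes _) = refl

    colouring : EdgeColouring G (2 + k)
    colouring = record
      { colour     = λ {u} {v} _ → paint u v (isHub? u) (isHub? v)
      ; colour-sym = λ {u} {v} _ _ → paint-sym u v (isHub? u) (isHub? v)
      }

    colour : Fin order → Fin order → Fin (2 + k)
    colour u v = paint u v (isHub? u) (isHub? v)

    colour-hub : ∀ {u i} → ¬ IsHub u → colour u (hub i) ≡ κ u i
    colour-hub {u} {i} ¬h = painted (isHub? u) (isHub? (hub i))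
      where
      painted : ∀ hu hi → paint u (hub i) hu hi ≡ κ u i
      painted (yes h) _              = contradiction h ¬h
      painted (no _)  (yes (j , eq)) = cong (κ u) (hub-injective eq)
      painted (no _)  (no ¬hi)       = contradiction (i , refl) ¬hi

    -- `paint` falls back to `zero` on edges inside the hubs or inside the non-hubs, so any other
    -- colour occurs only between the two; `hub-toNonHub` is the other half of this.
    nonHub-toHub : ∀ {u v c} → ¬ IsHub u → colour u v ≡ suc c → IsHub v
    nonHub-toHub {u} {v} {c} ¬h = painted (isHub? u) (isHub? v)
      where
      painted : ∀ hu hv → paint u v hu hv ≡ suc c → IsHub v
      painted (yes h) _       _ = contradiction h ¬h
      painted (no _)  (yes h) _ = h

    hub-toNonHub : ∀ {u v c} → IsHub u → colour u v ≡ suc c → ¬ IsHub v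
    hub-toNonHub {u} {v} {c} h = painted (isHub? u) (isHub? v)
      where
      painted : ∀ hu hv → paint u v hu hv ≡ suc c → ¬ IsHub v
      painted (no ¬h) _       _ = contradiction h ¬h
      painted (yes _) (no ¬h) _ = ¬h

    -- The leaves are hubs adjacent to `x`, hence positions in `A`, and the draws of `x` contain at
    -- most `ss i ∸ 1` balls of this colour.
    nonHub-star : ∀ {m x i} {leaf : Fin m → Fin order} → Injective _≡_ _≡_ leaf → ¬ IsHub x →
      (∀ q → x ~ leaf q × colour x (leaf q) ≡ suc (suc i)) → m ≤ ss i ∸ 1
    nonHub-star {m} {x} {i} {leaf} leaf-inj ¬h star = begin
      m
        ≡⟨ trans (sum-const m 1) (ℕ.*-identityʳ m) ⟨
      sum {m} (λ _ → 1)
        ≡⟨ sum-cong-≗ (λ q → counted q) ⟨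
      sum (chosen ∘ index)
        ≤⟨ sum-injective index-injective chosen ⟩
      sum chosen
        ≡⟨ draw-multiplicity A (urns A b) _ (suc (suc i)) ⟩
      multiplicity (urns A b) (suc (suc i))
        ≤⟨ urn-multiplicity (caps b ∣ A ∣) (caps-sum b ∣ A ∣) (suc (suc i)) ⟩
      caps b ∣ A ∣ (suc (suc i))
        ≡⟨ caps-rest b ∣ A ∣ i ⟩
      ss i ∸ 1 ∎
      where
      open ℕ.≤-Reasoning
      A = typeSet (τ x)
      b = proj₁ (remQuot {2} (∣ A ∣ !) (choice (τ x) x))
      leafHub : ∀ q → IsHub (leaf q)
      leafHub q = nonHub-toHub ¬h (proj₂ (star q))
      index : Fin m → Fin ℓ
      index q = proj₁ (leafHub q)
      index-injective : Injective _≡_ _≡_ index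
      index-injective {q} {q′} eq = leaf-inj (trans (sym (proj₂ (leafHub q))) (trans (cong hub eq) (proj₂ (leafHub q′))))
      chosen : Fin ℓ → ℕ
      chosen y = if lookup A y then ⟦ κ x y Fin.≟ suc (suc i) ⟧ else 0
      counted : ∀ q → chosen (index q) ≡ 1
      counted q rewrite ▷⇒∈typeSet {x} {index q} (¬h , subst (x ~_) (sym (proj₂ (leafHub q))) (proj₁ (star q))) =
        ⟦⟧-yes (κ x (index q) Fin.≟ suc (suc i))
          (trans (sym (colour-hub ¬h)) (trans (cong (colour x) (proj₂ (leafHub q))) (proj₂ (star q))))

    module _ {s′ n c} (copy : colourClass colouring c ContainsCopyOf K s′ n) where
      open _ContainsCopyOf_ copy

      left : Fin s′ → Fin order
      left p = embed (p ↑ˡ n)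

      right : Fin n → Fin order
      right q = embed (s′ ↑ʳ q)

      left-injective : Injective _≡_ _≡_ left
      left-injective eq = Fin.↑ˡ-injective n _ _ (injective eq)

      right-injective : Injective _≡_ _≡_ right
      right-injective eq = Fin.↑ʳ-injective s′ _ _ (injective eq)

      adjacent : ∀ p q → left p ~ right q × colour (left p) (right q) ≡ c
      adjacent p q = preserves (K-adjacent p q)

      adjacent′ : ∀ q p → right q ~ left p × colour (right q) (left p) ≡ c
      adjacent′ q p = preserves (opposite-sym (K-adjacent p q))

    -- One end of any edge of the copy is a non-hub. On the left it is the centre of a star with
    -- `ts i ≥ ss i` leaves, on the right of one with `ss i` leaves; `nonHub-star` excludes both.
    noSmallCopy : ∀ i → 1 ≤ ss i → ss i ≤ ts i → ¬ (colourClass colouring (suc (suc i)) ContainsCopyOf K (ss i) (ts i))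
    noSmallCopy i s≥1 s≤t copy with isHub? (left copy (fromℕ< s≥1))
    ... | no ¬h = ℕ.<⇒≱ (ℕ.≤-trans (ℕ.≤-reflexive (ℕ.m+[n∸m]≡n s≥1)) s≤t)
      (nonHub-star (right-injective copy) ¬h (adjacent copy (fromℕ< s≥1)))
    ... | yes h = ℕ.<⇒≱ (ℕ.≤-reflexive (ℕ.m+[n∸m]≡n s≥1))
      (nonHub-star (left-injective copy) (hub-toNonHub h (proj₂ (adjacent copy (fromℕ< s≥1) q))) (adjacent′ copy q))
      where q = fromℕ< (ℕ.≤-trans s≥1 s≤t)

    -- The left vertices have degree at least `n`, so they are hubs and form an `s`-set `S`. Each
    -- right vertex either hits `S` or is one of the `ℓ` hubs, where the default colour does no
    -- further harm.
    largeCopy : ∀ {n c} → (∀ v → n ≤ degree G v → IsHub v) → Halved c →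
      colourClass colouring c ContainsCopyOf K s n → P * n ≤ Q * (e G + overhead) + P * ℓ
    largeCopy {n} {c} high halved copy = begin
      P * n
        ≤⟨ ℕ.*-monoʳ-≤ P count ⟩
      P * (sum (starHits c S) + ℓ)
        ≡⟨ ℕ.*-distribˡ-+ P _ ℓ ⟩
      P * sum (starHits c S) + P * ℓ
        ≤⟨ ℕ.+-monoˡ-≤ (P * ℓ) (starHits-bound S halved (∣image∣ index-injective)) ⟩
      Q * (e G + overhead) + P * ℓ ∎
      where
      open ℕ.≤-Reasoning
      n≡ : sum {n} (λ _ → 1) ≡ n
      n≡ = trans (sum-const n 1) (ℕ.*-identityʳ n)
      leftHub : ∀ p → IsHub (left copy p)
      leftHub p = high (left copy p) (begin
        n                                          ≡⟨ n≡ ⟨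
        sum {n} (λ _ → 1)                          ≡⟨ sum-cong-≗ {n} (λ q → ⟦⟧-yes (left copy p ~? right copy q) (proj₁ (adjacent copy p q))) ⟨
        sum (λ q → ⟦ left copy p ~? right copy q ⟧)      ≤⟨ sum-injective (right-injective copy) (λ v → ⟦ left copy p ~? v ⟧) ⟩
        degree G (left copy p)                        ∎)
      index : Fin s → Fin ℓ
      index p = proj₁ (leftHub p)
      index-injective : Injective _≡_ _≡_ index
      index-injective {p} {p′} eq = left-injective copy (trans (sym (proj₂ (leftHub p))) (trans (cong hub eq) (proj₂ (leftHub p′))))
      S = image index
      hit : ∀ q → ¬ IsHub (right copy q) → starHits c S (right copy q) ≡ 1
      hit q ¬h = hits-yes c S (typeSet (τ (right copy q))) _ _ λ y y∈S → member y (∈-image⁻ index y y∈S)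
        where
        member : ∀ y → ∃[ p ] index p ≡ y →
          lookup (typeSet (τ (right copy q))) y ≡ true × κ (right copy q) y ≡ c
        member y (p , refl) =
          let adj , eq = subst (λ v → right copy q ~ v × colour (right copy q) v ≡ c) (sym (proj₂ (leftHub p))) (adjacent′ copy q p)
          in ▷⇒∈typeSet (¬h , adj) , trans (sym (colour-hub ¬h)) eq
      counted : ∀ q → 1 ≤ starHits c S (right copy q) + ⟦ isHub? (right copy q) ⟧
      counted q = cases (isHub? (right copy q))
        where
        cases : (d : Dec (IsHub (right copy q))) → 1 ≤ starHits c S (right copy q) + ⟦ d ⟧
        cases (yes _) = ℕ.m≤n+m 1 _
        cases (no ¬h) = ℕ.m≤n⇒m≤n+o 0 (ℕ.≤-reflexive (sym (hit q ¬h)))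
      count : n ≤ sum (starHits c S) + ℓ
      count = begin
        n
          ≡⟨ n≡ ⟨
        sum {n} (λ _ → 1)
          ≤⟨ sum-mono counted ⟩
        sum (λ q → starHits c S (right copy q) + ⟦ isHub? (right copy q) ⟧)
          ≤⟨ sum-injective (right-injective copy) (λ v → starHits c S v + ⟦ isHub? v ⟧) ⟩
        sum (λ v → starHits c S v + ⟦ isHub? v ⟧)
          ≡⟨ ∑-distrib-+ (starHits c S) (λ v → ⟦ isHub? v ⟧) ⟩
        sum (starHits c S) + sum (λ v → ⟦ isHub? v ⟧)
          ≤⟨ ℕ.+-monoʳ-≤ (sum (starHits c S)) (sum-mono λ v → ⟦⟧≤ (isHub? v) λ (i , eq) →
               ℕ.≤-trans (ℕ.≤-reflexive (sym (⟦⟧-yes (hub i Fin.≟ v) eq))) (term≤sum (λ i → ⟦ hub i Fin.≟ v ⟧) i)) ⟩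
        sum (starHits c S) + sum (λ v → sum λ i → ⟦ hub i Fin.≟ v ⟧)
          ≡⟨ cong (sum (starHits c S) +_) (trans (∑-comm (λ v i → ⟦ hub i Fin.≟ v ⟧))
               (trans (sum-cong-≗ λ i → sum-≟ (hub i)) (trans (sum-const ℓ 1) (ℕ.*-identityʳ ℓ)))) ⟩
        sum (starHits c S) + ℓ ∎

  -- The error terms of `largeCopy` with the number of hubs replaced by its bound `2 * P`, hence
  -- independent of `n` and `G`.
  slack : ℕ
  slack = Q * (2 ^ (2 * P) * (2 * (2 * P) ! * (2 * P))) + P * (2 * P)

  -- Either the inequality holds without `slack`, or `Q * e G < P * n`. The latter bounds the number
  -- of vertices of degree at least `n` by `2 * P`, since their degrees add up to at most `2 * e G`.
  lower : 1 ≤ Q → (∀ i → 1 ≤ ss i) → (∀ i → ss i ≤ ts i) →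
    ∀ n G → G ⟶ Hs n → P * n ≤ Q * e G + slack
  lower Q≥1 ss≥1 ss≤ts n G G⟶Hs with P * n ℕ.≤? Q * e G
  ... | yes Pn≤Qe = ℕ.m≤n⇒m≤n+o slack Pn≤Qe
  ... | no Pn≰Qe = fromCopy (G⟶Hs colouring)
    where
    open Graph G
    open ℕ.≤-Reasoning
    high? : U.Decidable (λ v → n ≤ degree G v)
    high? v = n ℕ.≤? degree G v
    open Enumeration (enumerate high?)
    ℓ = sum λ v → ⟦ high? v ⟧
    open Construction G injective

    ℓn≤2e : ℓ * n ≤ 2 * e G
    ℓn≤2e = begin
      ℓ * n                    ≡⟨ sum-const ℓ n ⟨
      sum {ℓ} (λ _ → n)        ≤⟨ sum-mono sound ⟩
      sum (degree G ∘ elem)    ≤⟨ sum-injective injective (degree G) ⟩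
      sum (degree G)           ≡⟨ handshake G ⟩
      2 * e G                  ∎

    ℓ≤2P : ℓ ≤ 2 * P
    ℓ≤2P = ℕ.<⇒≤ (ℕ.*-cancelʳ-< n ℓ (2 * P) (begin-strict
      ℓ * n            ≤⟨ ℓn≤2e ⟩
      2 * e G          ≤⟨ ℕ.*-monoʳ-≤ 2 (ℕ.m≤n*m (e G) Q {{>-nonZero Q≥1}}) ⟩
      2 * (Q * e G)    <⟨ ℕ.*-monoʳ-< 2 (ℕ.≰⇒> Pn≰Qe) ⟩
      2 * (P * n)      ≡⟨ ℕ.*-assoc 2 P n ⟨
      2 * P * n        ∎))

    large : ∀ {c} → Halved c → colourClass colouring c ContainsCopyOf K s n → P * n ≤ Q * e G + slack
    large halved copy = begin
      P * n
        ≤⟨ largeCopy (λ v → complete) halved copy ⟩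
      Q * (e G + overhead) + P * ℓ
        ≡⟨ trans (cong (_+ P * ℓ) (ℕ.*-distribˡ-+ Q (e G) overhead)) (ℕ.+-assoc (Q * e G) _ _) ⟩
      Q * e G + (Q * overhead + P * ℓ)
        ≤⟨ ℕ.+-monoʳ-≤ (Q * e G) (ℕ.+-mono-≤
             (ℕ.*-monoʳ-≤ Q (ℕ.*-mono-≤ (ℕ.^-monoʳ-≤ 2 ℓ≤2P) (ℕ.*-mono-≤ (ℕ.*-monoʳ-≤ 2 (!-mono ℓ≤2P)) ℓ≤2P)))
             (ℕ.*-monoʳ-≤ P ℓ≤2P)) ⟩
      Q * e G + slack ∎

    fromCopy : ∃[ i ] colourClass colouring i ContainsCopyOf Hs n i → P * n ≤ Q * e G + slack
    fromCopy (zero        , copy) = large halved-first copy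
    fromCopy (suc zero    , copy) = large halved-second copy
    fromCopy (suc (suc i) , copy) = contradiction copy (noSmallCopy i (ss≥1 i) (ss≤ts i))

-- Rationals and the minimum of a · f(a)

frac : ℕ → (d : ℕ) .{{_ : NonZero d}} → ℚ
frac p d = ℤ.+ p ℚ./ d

frac-≃ : ∀ p d → ℚ.toℚᵘ (frac p (suc d)) ℚᵘ.≃ ℚᵘ.mkℚᵘ (ℤ.+ p) d
frac-≃ p d = ℚ.toℚᵘ-fromℚᵘ (ℚᵘ.mkℚᵘ (ℤ.+ p) d)

frac-≤ : ∀ p d q d′ .{{_ : NonZero d}} .{{_ : NonZero d′}} → p * d′ ≤ q * d → frac p d ℚ.≤ frac q d′
frac-≤ p (suc d) q (suc d′) le = ℚ.toℚᵘ-cancel-≤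
  (ℚᵘ.≤-respˡ-≃ (ℚᵘ.≃-sym (frac-≃ p d)) (ℚᵘ.≤-respʳ-≃ (ℚᵘ.≃-sym (frac-≃ q d′))
    (ℚᵘ.*≤* (subst₂ ℤ._≤_ (ℤ.pos-* p (suc d′)) (ℤ.pos-* q (suc d)) (ℤ.+≤+ le)))))

frac-≤⁻¹ : ∀ p d q d′ .{{_ : NonZero d}} .{{_ : NonZero d′}} → frac p d ℚ.≤ frac q d′ → p * d′ ≤ q * d
frac-≤⁻¹ p (suc d) q (suc d′) le with
  ℚᵘ.≤-respˡ-≃ (frac-≃ p d) (ℚᵘ.≤-respʳ-≃ (frac-≃ q d′) (ℚ.toℚᵘ-mono-≤ le))
... | ℚᵘ.*≤* le′ = ℤ.drop‿+≤+ (subst₂ ℤ._≤_ (sym (ℤ.pos-* p (suc d′))) (sym (ℤ.pos-* q (suc d))) le′)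

frac-cong : ∀ p d q d′ .{{_ : NonZero d}} .{{_ : NonZero d′}} → p * d′ ≡ q * d → frac p d ≡ frac q d′
frac-cong p d q d′ eq = ℚ.≤-antisym (frac-≤ p d q d′ (ℕ.≤-reflexive eq)) (frac-≤ q d′ p d (ℕ.≤-reflexive (sym eq)))

fromℕ-*-frac : ∀ a p d .{{_ : NonZero d}} → fromℕ a ℚ.* frac p d ≡ frac (a * p) d
fromℕ-*-frac a p (suc d) = ℚ.toℚᵘ-injective (begin
  ℚ.toℚᵘ (fromℕ a ℚ.* frac p (suc d))                    ≈⟨ ℚ.toℚᵘ-homo-* (fromℕ a) (frac p (suc d)) ⟩
  ℚ.toℚᵘ (fromℕ a) ℚᵘ.* ℚ.toℚᵘ (frac p (suc d))          ≈⟨ ℚᵘ.*-cong (frac-≃ a 0) (frac-≃ p d) ⟩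
  ℚᵘ.mkℚᵘ (ℤ.+ a) 0 ℚᵘ.* ℚᵘ.mkℚᵘ (ℤ.+ p) d               ≈⟨ ℚᵘ.*≡* (cong₂ ℤ._*_ (sym (ℤ.pos-* a p)) (cong (ℤ.+_ ∘ suc) (sym (ℕ.+-identityʳ d)))) ⟩
  ℚᵘ.mkℚᵘ (ℤ.+ (a * p)) d                                ≈⟨ frac-≃ (a * p) d ⟨
  ℚ.toℚᵘ (frac (a * p) (suc d))                          ∎)
  where open ℚᵘ.≃-Reasoning

fromℕ-+-frac : ∀ b p d .{{_ : NonZero d}} → fromℕ b ℚ.+ frac p d ≡ frac (b * d + p) d
fromℕ-+-frac b p (suc d) = ℚ.toℚᵘ-injective (begin
  ℚ.toℚᵘ (fromℕ b ℚ.+ frac p (suc d))                    ≈⟨ ℚ.toℚᵘ-homo-+ (fromℕ b) (frac p (suc d)) ⟩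
  ℚ.toℚᵘ (fromℕ b) ℚᵘ.+ ℚ.toℚᵘ (frac p (suc d))          ≈⟨ ℚᵘ.+-cong (frac-≃ b 0) (frac-≃ p d) ⟩
  ℚᵘ.mkℚᵘ (ℤ.+ b) 0 ℚᵘ.+ ℚᵘ.mkℚᵘ (ℤ.+ p) d               ≈⟨ ℚᵘ.*≡* (cong₂ ℤ._*_ numerator (cong (ℤ.+_ ∘ suc) (sym (ℕ.+-identityʳ d)))) ⟩
  ℚᵘ.mkℚᵘ (ℤ.+ (b * suc d + p)) d                        ≈⟨ frac-≃ (b * suc d + p) d ⟨
  ℚ.toℚᵘ (frac (b * suc d + p) (suc d))                  ∎)
  where
  open ℚᵘ.≃-Reasoning
  numerator : ℤ.+ b ℤ.* ℤ.+ suc d ℤ.+ ℤ.+ p ℤ.* ℤ.+ 1 ≡ ℤ.+ (b * suc d + p)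
  numerator = cong₂ ℤ._+_ (sym (ℤ.pos-* b (suc d))) (ℤ.*-identityʳ (ℤ.+ p))

p≤b+q⇒p-q≤b : ∀ {p b q} → p ℚ.≤ b ℚ.+ q → p ℚ.- q ℚ.≤ b
p≤b+q⇒p-q≤b {p} {b} {q} le = begin
  p ℚ.- q               ≤⟨ ℚ.+-monoˡ-≤ (ℚ.- q) le ⟩
  b ℚ.+ q ℚ.- q         ≡⟨ ℚ.+-assoc b q (ℚ.- q) ⟩
  b ℚ.+ (q ℚ.- q)       ≡⟨ cong (b ℚ.+_) (ℚ.+-inverseʳ q) ⟩
  b ℚ.+ ℚ.0ℚ            ≡⟨ ℚ.+-identityʳ b ⟩
  b                     ∎
  where open ℚ.≤-Reasoning

∣p-q∣≤b : ∀ {p q b} → p ℚ.≤ b ℚ.+ q → q ℚ.≤ b ℚ.+ p → ℚ.∣ p ℚ.- q ∣ ℚ.≤ b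
∣p-q∣≤b {p} {q} p≤b+q q≤b+p with ℚ.∣p∣≡p∨∣p∣≡-p (p ℚ.- q)
... | inj₁ eq = subst (ℚ._≤ _) (sym eq) (p≤b+q⇒p-q≤b p≤b+q)
... | inj₂ eq = subst (ℚ._≤ _) (sym (trans eq (⁻¹-anti-homo-// p q))) (p≤b+q⇒p-q≤b q≤b+p)

-- Dividing the two integer inequalities by `Q` gives the error `c / Q`, which is weakened to `c`.
distance-≤ : ∀ {P Q r n c} .{{_ : NonZero Q}} → P * n ≤ Q * r + c → Q * r ≤ P * n + c →
  ℚ.∣ fromℕ r ℚ.- fromℕ n ℚ.* frac P Q ∣ ℚ.≤ fromℕ c
distance-≤ {P} {Q} {r} {n} {c} below above = subst (λ z → ℚ.∣ fromℕ r ℚ.- z ∣ ℚ.≤ fromℕ c) (sym (fromℕ-*-frac n P Q)) (∣p-q∣≤b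
  (subst (fromℕ r ℚ.≤_) (sym (fromℕ-+-frac c (n * P) Q)) (frac-≤ r 1 (c * Q + n * P) Q (begin
    r * Q                ≡⟨ ℕ.*-comm r Q ⟩
    Q * r                ≤⟨ above ⟩
    P * n + c            ≤⟨ ℕ.+-monoʳ-≤ (P * n) (ℕ.m≤m*n c Q) ⟩
    P * n + c * Q        ≡⟨ arrange₁ P n (c * Q) ⟩
    (c * Q + n * P) * 1  ∎)))
  (subst (frac (n * P) Q ℚ.≤_) (sym (fromℕ-+-frac c r 1)) (frac-≤ (n * P) Q (c * 1 + r) 1 (begin
    n * P * 1            ≡⟨ arrange₂ n P ⟩
    P * n                ≤⟨ below ⟩
    Q * r + c            ≤⟨ ℕ.+-monoʳ-≤ (Q * r) (ℕ.m≤m*n c Q) ⟩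
    Q * r + c * Q        ≡⟨ arrange₃ Q r c ⟩
    (c * 1 + r) * Q      ∎))))
  where
  open ℕ.≤-Reasoning
  arrange₁ : ∀ p n c → p * n + c ≡ (c + n * p) * 1
  arrange₁ = solve-∀
  arrange₂ : ∀ n p → n * p * 1 ≡ p * n
  arrange₂ = solve-∀
  arrange₃ : ∀ q r c → q * r + c * q ≡ (c * 1 + r) * q
  arrange₃ = solve-∀

argmin : (v : ℕ → ℚ) → ∀ m → ∃[ j ] ∀ i → i ≤ m → v j ℚ.≤ v i
argmin v zero    = 0 , λ { zero z≤n → ℚ.≤-refl }
argmin v (suc m) with argmin v m
... | j , vj≤ with ℚ.≤-total (v j) (v (suc m))
...   | inj₁ vj≤v = j , λ i i≤1+m → case ℕ.m≤n⇒m<n∨m≡n i≤1+m of λ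
  { (inj₁ (s≤s i≤m)) → vj≤ i i≤m ; (inj₂ refl) → vj≤v }
...   | inj₂ v≤vj = suc m , λ i i≤1+m → case ℕ.m≤n⇒m<n∨m≡n i≤1+m of λ
  { (inj₁ (s≤s i≤m)) → ℚ.≤-trans v≤vj (vj≤ i i≤m) ; (inj₂ refl) → ℚ.≤-refl }

module Minimum {k} (s : ℕ) (ss ts : Vector ℕ k) (s≥1 : 1 ≤ s) (ss≥1 : ∀ i → 1 ≤ ss i) where
  open Objective s ss s≥1 ss≥1
  open Forbidden s ss ts using (d; D)

  numerator : ℕ → ℕ
  numerator a = a * (2 * (a C s))

  value : ∀ a → a > σ → ℚ
  value a a>σ = fromℕ a ℚ.* f a a>σ

  value≡ : ∀ a (a>σ : a > σ) → value a a>σ ≡ frac (numerator a) (denominator a) {{denominator-nonZero a>σ}}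
  value≡ a a>σ = fromℕ-*-frac a (2 * (a C s)) (denominator a) {{denominator-nonZero a>σ}}

  D≡ : ∀ a → D a ≡ s ! * denominator a
  D≡ a = trans (cong₂ _+_ (fall≡!*C ⌊ a ∸ d /2⌋ s) (fall≡!*C ⌈ a ∸ d /2⌉ s)) (sym (ℕ.*-distribˡ-+ (s !) _ _))

  numerator≡ : ∀ a → a * (2 * fall a s) ≡ s ! * numerator a
  numerator≡ a = trans (cong (λ z → a * (2 * z)) (fall≡!*C a s)) (arrange a (s !) (a C s))
    where
    arrange : ∀ a f c → a * (2 * (f * c)) ≡ f * (a * (2 * c))
    arrange = solve-∀

  -- As `σ = 2 * s − 2 + d`, the hypothesis gives `a ∸ d ≤ 2 * s − 2`, so even the larger half is
  -- below `s`.
  D-zero : ∀ a → a ≤ σ → D a ≡ 0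
  D-zero a a≤σ = cong₂ _+_ (fall-zero (ℕ.≤-<-trans (ℕ.⌊n/2⌋≤⌈n/2⌉ (a ∸ d)) ceil<s)) (fall-zero ceil<s)
    where
    bound : ∀ s → 1 ≤ s → a ≤ (2 * s + sum ss) ∸ (2 + k) → ⌈ a ∸ d /2⌉ < s
    bound (suc t) _ a≤ = s≤s (begin
      ⌈ a ∸ d /2⌉                                   ≤⟨ ℕ.⌈n/2⌉-mono (ℕ.∸-monoˡ-≤ d a≤) ⟩
      ⌈ 2 * suc t + sum ss ∸ (2 + k) ∸ d /2⌉        ≡⟨ cong (λ z → ⌈ 2 * suc t + z ∸ (2 + k) ∸ d /2⌉) (sum-pred ss ss≥1) ⟨
      ⌈ 2 * suc t + (k + d) ∸ (2 + k) ∸ d /2⌉       ≡⟨ cong (λ z → ⌈ z ∸ (2 + k) ∸ d /2⌉) (arrange t k d) ⟩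
      ⌈ (2 + k) + (t + t + d) ∸ (2 + k) ∸ d /2⌉     ≡⟨ cong (λ z → ⌈ z ∸ d /2⌉) (ℕ.m+n∸m≡n (2 + k) (t + t + d)) ⟩
      ⌈ t + t + d ∸ d /2⌉                           ≡⟨ cong ⌈_/2⌉ (ℕ.m+n∸n≡m (t + t) d) ⟩
      ⌈ t + t /2⌉                                   ≡⟨ ℕ.n≡⌈n+n/2⌉ t ⟨
      t                                             ∎)
      where
      open ℕ.≤-Reasoning
      arrange : ∀ t k d → 2 * suc t + (k + d) ≡ (2 + k) + (t + t + d)
      arrange = solve-∀
    ceil<s : ⌈ a ∸ d /2⌉ < s
    ceil<s = bound s s≥1 a≤σ

  -- This says `f(a) ≥ 1`, so that the values `a · f(a)` grow without bound and a minimum exists.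
  denominator≤ : ∀ a → denominator a ≤ 2 * (a C s)
  denominator≤ a = ℕ.*-cancelˡ-≤ (s !) {{s ℕ.!≢0}} (begin
    s ! * denominator a                           ≡⟨ D≡ a ⟨
    fall ⌊ a ∸ d /2⌋ s + fall ⌈ a ∸ d /2⌉ s       ≤⟨ ℕ.+-mono-≤ (fall-mono s (ℕ.≤-trans (ℕ.⌊n/2⌋≤n (a ∸ d)) (ℕ.m∸n≤m a d)))
                                                                (fall-mono s (ℕ.≤-trans (ℕ.⌈n/2⌉≤n (a ∸ d)) (ℕ.m∸n≤m a d))) ⟩
    fall a s + fall a s                           ≡⟨ cong₂ _+_ (fall≡!*C a s) (fall≡!*C a s) ⟩
    s ! * (a C s) + s ! * (a C s)                 ≡⟨ arrange (s !) (a C s) ⟩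
    s ! * (2 * (a C s))                           ∎)
    where
    open ℕ.≤-Reasoning
    arrange : ∀ f c → f * c + f * c ≡ f * (2 * c)
    arrange = solve-∀

  v : ℕ → ℚ
  v i = value (suc σ + i) (ℕ.m≤m+n (suc σ) i)

  -- Since a ≤ a · f(a), only finitely many a can compete with a = σ + 1.
  first≤ : ∀ i → numerator (suc σ) ≤ i → v 0 ℚ.≤ v i
  first≤ i large = subst₂ ℚ._≤_ (sym (value≡ a₀ a₀>σ)) (sym (value≡ a a>σ))
    (frac-≤ (numerator a₀) (denominator a₀) (numerator a) (denominator a) {{denominator-nonZero a₀>σ}} {{denominator-nonZero a>σ}} (begin
      numerator a₀ * denominator a          ≤⟨ ℕ.*-mono-≤ (ℕ.≤-trans (ℕ.≤-reflexive (cong numerator (ℕ.+-identityʳ (suc σ)))) (ℕ.m≤n⇒m≤o+n (suc σ) large)) (denominator≤ a) ⟩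
      numerator a                           ≤⟨ ℕ.m≤m*n (numerator a) (denominator a₀) {{denominator-nonZero a₀>σ}} ⟩
      numerator a * denominator a₀          ∎))
    where
    open ℕ.≤-Reasoning
    a₀ = suc σ + 0
    a = suc σ + i
    a₀>σ = ℕ.m≤m+n (suc σ) 0
    a>σ = ℕ.m≤m+n (suc σ) i

  -- `argmin` settles the indices up to `numerator (suc σ)`; beyond them `first≤` shows that `v 0`
  -- is no larger.
  optimum : ∃[ a ] Σ[ a>σ ∈ a > σ ] ∀ b (b>σ : b > σ) → value a a>σ ℚ.≤ value b b>σ
  optimum = fromFirst (argmin v (numerator (suc σ)))
    where
    at : ∀ {p} i {b} → (∀ i → p ℚ.≤ v i) → suc σ + i ≡ b → (b>σ : b > σ) → p ℚ.≤ value b b>σ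
    -- `value` carries a proof of `a > σ`; all such proofs are equal, so the one built into `v` may
    -- be exchanged for `b>σ`.
    at {p} i p≤v refl b>σ = subst (λ gt → p ℚ.≤ value (suc σ + i) gt) (ℕ.<-irrelevant (ℕ.m≤m+n (suc σ) i) b>σ) (p≤v i)
    fromFirst : ∃[ j ] (∀ i → i ≤ numerator (suc σ) → v j ℚ.≤ v i) →
      ∃[ a ] Σ[ a>σ ∈ a > σ ] ∀ b (b>σ : b > σ) → value a a>σ ℚ.≤ value b b>σ
    fromFirst (j , v≤) = suc σ + j , ℕ.m≤m+n (suc σ) j ,
      λ b b>σ → at {v j} (b ∸ suc σ) vj≤ (ℕ.m+[n∸m]≡n b>σ) b>σ
      where
      vj≤ : ∀ i → v j ℚ.≤ v i
      vj≤ i = [ v≤ i , (λ large → ℚ.≤-trans (v≤ 0 z≤n) (first≤ i large)) ]′ (ℕ.≤-total i (numerator (suc σ)))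

  module Optimum (a* : ℕ) (a*>σ : a* > σ) (μ≤ : ∀ b (b>σ : b > σ) → value a* a*>σ ℚ.≤ value b b>σ) where

    μ : ℚ
    μ = value a* a*>σ

    μ-least : IsLeast ℚ._≤_ Values μ
    μ-least = (a* , a*>σ , refl) , λ { _ (a , a>σ , refl) → μ≤ a a>σ }

    -- Numerator and denominator of `μ`, both multiplied by `s !`: in this form they are the counts
    -- of injections that occur in `upper` and `lower`.
    P Q : ℕ
    P = a* * (2 * fall a* s)
    Q = D a*

    Q≥1 : 1 ≤ Q
    Q≥1 = ℕ.≤-trans (ℕ.*-mono-≤ (>-nonZero⁻¹ (s !) {{s ℕ.!≢0}}) (>-nonZero⁻¹ (denominator a*) {{denominator-nonZero a*>σ}}))
      (ℕ.≤-reflexive (sym (D≡ a*)))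

    μ≡ : μ ≡ frac P Q {{>-nonZero Q≥1}}
    μ≡ = trans (value≡ a* a*>σ) (frac-cong (numerator a*) (denominator a*) P Q {{denominator-nonZero a*>σ}} {{>-nonZero Q≥1}} (begin
      numerator a* * Q                          ≡⟨ cong (numerator a* *_) (D≡ a*) ⟩
      numerator a* * (s ! * denominator a*)     ≡⟨ arrange (numerator a*) (s !) (denominator a*) ⟩
      s ! * numerator a* * denominator a*       ≡⟨ cong (_* denominator a*) (numerator≡ a*) ⟨
      P * denominator a*                        ∎))
      where
      open ≡-Reasoning
      arrange : ∀ x f y → x * (f * y) ≡ f * x * y
      arrange = solve-∀

    -- For `a > σ` this is `μ ≤ a · f(a)` with denominators cleared and scaled by `s ! * s !`; for
    -- `a ≤ σ` the left side vanishes by `D-zero`.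
    optimal : ∀ a → P * D a ≤ Q * (a * (2 * fall a s))
    optimal a = cases (a ℕ.≤? σ)
      where
      cases : Dec (a ≤ σ) → P * D a ≤ Q * (a * (2 * fall a s))
      cases (yes a≤σ) = ℕ.≤-trans (ℕ.≤-reflexive (trans (cong (P *_) (D-zero a a≤σ)) (ℕ.*-zeroʳ P))) z≤n
      cases (no a≰σ) = begin
        P * D a                                               ≡⟨ cong₂ _*_ (numerator≡ a*) (D≡ a) ⟩
        s ! * numerator a* * (s ! * denominator a)            ≡⟨ arrange₁ (s !) (numerator a*) (denominator a) ⟩
        s ! * s ! * (numerator a* * denominator a)            ≤⟨ ℕ.*-monoʳ-≤ (s ! * s !) cross ⟩
        s ! * s ! * (numerator a * denominator a*)            ≡⟨ arrange₂ (s !) (numerator a) (denominator a*) ⟩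
        s ! * denominator a* * (s ! * numerator a)            ≡⟨ cong₂ _*_ (D≡ a*) (numerator≡ a) ⟨
        Q * (a * (2 * fall a s))                              ∎
        where
        open ℕ.≤-Reasoning
        arrange₁ : ∀ f x y → f * x * (f * y) ≡ f * f * (x * y)
        arrange₁ = solve-∀
        arrange₂ : ∀ f x y → f * f * (x * y) ≡ f * y * (f * x)
        arrange₂ = solve-∀
        a>σ = ℕ.≰⇒> a≰σ
        cross : numerator a* * denominator a ≤ numerator a * denominator a*
        cross = frac-≤⁻¹ (numerator a*) (denominator a*) (numerator a) (denominator a) {{denominator-nonZero a*>σ}} {{denominator-nonZero a>σ}}
          (subst₂ ℚ._≤_ (value≡ a* a*>σ) (value≡ a a>σ) (μ≤ a a>σ))

-- Assembling the asymptotic formula from the two bounds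

K-noIsolated : ∀ {m n} → 1 ≤ m → 1 ≤ n → NoIsolatedVertices (K m n)
K-noIsolated {suc m} {suc n} _ _ u with splitAt (suc m) u
... | inj₁ p = suc m ↑ʳ zero , subst (Opposite (inj₁ p)) (sym (Fin.splitAt-↑ʳ (suc m) (suc n) zero)) left-right
... | inj₂ q = zero ↑ˡ suc n , subst (Opposite (inj₂ q)) (sym (Fin.splitAt-↑ˡ (suc m) zero (suc n))) right-left

theorem10 : ∀ {k} (s : ℕ) (ss ts : Vector ℕ k)
    (s≥1 : 1 ≤ s) (ss≥1 : ∀ i → 1 ≤ ss i) (ts≥1 : ∀ i → 1 ≤ ts i) →
    (∀ i → ss i ≤ ts i) →
    ∃[ μ ] IsLeast ℚ._≤_ (Objective.Values s ss s≥1 ss≥1) μ ×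
    (∃[ B ] ∃[ N ] ∀ n → N ≤ n →
    ∃[ r̂ ] IsSizeRamseyNumber (K s n ∷ K s n ∷ λ i → K (ss i) (ts i)) r̂ ×
    ℚ.∣ fromℕ r̂ ℚ.- fromℕ n ℚ.* μ ∣ ℚ.≤ fromℕ B)
theorem10 {k} s ss ts s≥1 ss≥1 ts≥1 ss≤ts = fromOptimum (Minimum.optimum s ss ts s≥1 ss≥1)
  where
  open Objective s ss s≥1 ss≥1
  open Minimum s ss ts s≥1 ss≥1 using (value)
  open Forbidden s ss ts using (Hs; upper; exceptions)

  noIsolated : ∀ {n} → 1 ≤ n → ∀ i → NoIsolatedVertices (Hs n i)
  noIsolated n≥1 zero          = K-noIsolated s≥1 n≥1
  noIsolated n≥1 (suc zero)    = K-noIsolated s≥1 n≥1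
  noIsolated n≥1 (suc (suc i)) = K-noIsolated (ss≥1 i) (ts≥1 i)

  fromOptimum : ∃[ a ] (Σ[ a>σ ∈ a > σ ] ∀ b (b>σ : b > σ) → value a a>σ ℚ.≤ value b b>σ) →
    ∃[ μ ] IsLeast ℚ._≤_ Values μ × (∃[ B ] ∃[ N ] ∀ n → N ≤ n →
      ∃[ r̂ ] IsSizeRamseyNumber (Hs n) r̂ × ℚ.∣ fromℕ r̂ ℚ.- fromℕ n ℚ.* μ ∣ ℚ.≤ fromℕ B)
  -- The threshold is 1 because `K s n` has no isolated vertices as soon as `n ≥ 1`.
  fromOptimum (a* , a*>σ , μ≤) = μ , μ-least , B , 1 , λ n n≥1 → asymptotics n n≥1 (upper a* Q≥1 n)
    where
    open Minimum.Optimum s ss ts s≥1 ss≥1 a* a*>σ μ≤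
    open LowerBound s ss ts P Q optimal using (lower; slack)
    instance _ = >-nonZero Q≥1
    -- The error of the lower bound plus that of the upper bound, so that one constant serves both
    -- directions.
    B = slack + a* * Q * suc (exceptions a*)

    asymptotics : ∀ n → 1 ≤ n → Σ[ G ∈ Graph ] (G ⟶ Hs n × Q * e G ≤ P * n + a* * Q * suc (exceptions a*)) →
      ∃[ r̂ ] IsSizeRamseyNumber (Hs n) r̂ × ℚ.∣ fromℕ r̂ ℚ.- fromℕ n ℚ.* μ ∣ ℚ.≤ fromℕ B
    asymptotics n n≥1 (G , G⟶ , small) = close (sizeRamseyNumber-exists (Hs n) (noIsolated n≥1) G G⟶)
      where
      close : ∃[ r̂ ] IsSizeRamseyNumber (Hs n) r̂ →
        ∃[ r̂ ] IsSizeRamseyNumber (Hs n) r̂ × ℚ.∣ fromℕ r̂ ℚ.- fromℕ n ℚ.* μ ∣ ℚ.≤ fromℕ B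
      close (r̂ , (G₀ , refl , G₀⟶) , r̂≤) = r̂ , ((G₀ , refl , G₀⟶) , r̂≤) ,
        subst (λ μ → ℚ.∣ fromℕ r̂ ℚ.- fromℕ n ℚ.* μ ∣ ℚ.≤ fromℕ B) (sym μ≡)
          (distance-≤ {P} {Q} {r̂} {n} {B}
            (ℕ.≤-trans (lower Q≥1 ss≥1 ss≤ts n G₀ G₀⟶) (ℕ.+-monoʳ-≤ (Q * r̂) (ℕ.m≤m+n slack _)))
            (ℕ.≤-trans (ℕ.*-monoʳ-≤ Q (r̂≤ (e G) (G , refl , G⟶)))
              (ℕ.≤-trans small (ℕ.+-monoʳ-≤ (P * n) (ℕ.m≤n+m _ slack)))))
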